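{- (General purity completeness) Suppose that $R$ satisfies condition (C): for all $p\in(0,1)$ and all $s<0$ in $R$ there are $l,r\in R$ such that $s+(r+_pl)>l$. Let $\mathrm{Ax}$ be a theory extending $\mathrm{Ax}_1$ that is valid in $\mathcal S_T$. If $\mathrm{Ax}$ is strongly purity complete for basic PR-effect values, then it is strongly purity complete at base types; i.e., for every base type $b$ and every program $M:b$, if $\models_{\mathcal S_T}M\downarrow_b$ then there is a constant $c:b$ with $\vdash_{\mathrm{Ax}}M=c:b$.
   Context: **Language.** Fix base types $b$, including $\mathtt{Bool}$ and $\mathtt{Rew}$; for each $b$ a set of constants $c:b$ (including $\mathtt{tt},\mathtt{ff}:\mathtt{Bool}$, $0:\mathtt{Rew}$); and function symbols $f:b_1\ldots b_m\to b$, including $=_b\,:b\,b\to\mathtt{Bool}$ for each $b$, $+:\mathtt{Rew}\,\mathtt{Rew}\to\mathtt{Rew}$, $\oplus_p:\mathtt{Rew}\,\mathtt{Rew}\to\mathtt{Rew}$ ($p\in[0,1]$) and $\le\,:\mathtt{Rew}\,\mathtt{Rew}\to\mathtt{Bool}$ ($x\ge y$ means $y\le x$). Types: $\sigma::=b\mid\mathtt{Unit}\mid\sigma\times\sigma\mid\sigma\to\sigma$. Terms: $M::=x\mid c\mid f(M_1,\dots,M_m)\mid\mathtt{if}\,L\,\mathtt{then}\,M\,\mathtt{else}\,N\mid M\,\mathtt{or}\,N\mid N\cdot M\mid M+_pN\ (p\in[0,1])\mid *\mid\langle M,N\rangle\mid\mathtt{fst}(M)\mid\mathtt{snd}(M)\mid\lambda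 x{:}\sigma.M\mid MN$, up to $\alpha$-equivalence, with standard simple typing; $M\,\mathtt{or}\,N$ and $M+_pN$ have type $\sigma$ when $M,N:\sigma$, and $N\cdot M:\sigma$ when $N:\mathtt{Rew}$, $M:\sigma$. $\mathtt{let}\,x{:}\sigma\,\mathtt{be}\,M\,\mathtt{in}\,N$ abbreviates $(\lambda x{:}\sigma.N)M$. Programs are closed well-typed terms. Constants $\mathrm{val}_f(c_1,\dots,c_m):b$ are given for all $f:b_1\ldots b_m\to b$ and $c_i:b_i$, with $\mathrm{val}_{=_b}(c,c')=\mathtt{tt}$ if $c=c'$, else $\mathtt{ff}$. **Rewards and interpretation.** A barycentric algebra is a set with binary operations $+_p$ ($p\in[0,1]$) such that $x+_1y=x$, $x+_px=x$, $x+_py=y+_{1-p}x$ and $(x+_py)+_qz=x+_{pq}(y+_{(1-p)q/(1-pq)}z)$ for $p,q<1$. $R$ is a set with a barycentric algebra structure $+_p$, a commutative monoid structure $(+,0)$ with $r+(s+_ps')=(r+s)+_p(r+s')$, and a total order $\le$ such that for all $r,s,t$: $r\le s\iff r+t\le s+t$, and $r\le s\iff r+_pt\le s+_pt$ for $p\in(0,1)$. Given are nonempty sets $[\![b]\!]$ with $[\![\mathtt{Bool}]\!]=\{0,1\}$, $[\![\mathtt{Rew}]\!]=R$; elements $[\![c]\!]\in[\![b]\!]$ for $c:b$ with $[\![\mathtt{tt}]\!]=1$, $[\![\mathtt{ff}]\!]=0$, $[\![0]\!]=0$, distinct constants of the same type having distinct denotations, and $[\![c]\!]\ne0$ for some $c:\mathtt{Rew}$;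 and functions $[\![f]\!]:[\![b_1]\!]\times\cdots\times[\![b_m]\!]\to[\![b]\!]$ with $[\![+]\!],[\![\oplus_p]\!],[\![\le]\!]$ the addition, the operation $+_p$ and the (characteristic function of the) order of $R$, and $[\![f]\!]([\![c_1]\!],\dots,[\![c_m]\!])=[\![\mathrm{val}_f(c_1,\dots,c_m)]\!]$. **Auxiliary monad.** A barycentric $R$-module is a barycentric algebra with an action of $R$ ($0\cdot x=x$, $r\cdot(s\cdot x)=(r+s)\cdot x$) such that $r\cdot(x+_py)=r\cdot x+_pr\cdot y$. $T$ is a monad on sets (unit $\eta_T$, Kleisli extension $(-)^{\dagger_T}$), with operations $\cdot_T:R\times T(X)\to T(X)$ and $+_p:T(X)^2\to T(X)$ for all sets $X$ commuting with all Kleisli extensions (i.e. $T$-algebraic operations), and a $T$-algebra $\alpha_T:T(R)\to R$, such that (A1) each $T(X)$ is a barycentric $R$-module, and (A2) $\alpha_T(r\cdot u)=r+\alpha_T(u)$, $\alpha_T(u+_pv)=\alpha_T(u)+_p\alpha_T(v)$. **Denotational semantics $\mathcal S=\mathcal S_T$.** $S(X)=(X\to R)\to T(X)$. For $F\in S(X)$, $\gamma:X\to R$ put $\mathbf R(F|\gamma)=\alpha_T(T(\gamma)(F(\gamma)))$. $S$ is a monad with $\eta(x)(\gamma)=\eta_T(x)$ and, for $f:X\to S(Y)$, $f^\dagger(F)(\gamma)=(\lambda x.\,f(x)(\gamma))^{\dagger_T}\big(F(\lambda x.\,\mathbf R(f(x)|\gamma))\big)$. Operations: $(G_0\,\mathtt{or}\,G_1)(\gamma)=G_0(\gamma)$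 if $\mathbf R(G_0|\gamma)\ge\mathbf R(G_1|\gamma)$, else $G_1(\gamma)$; $(r\cdot G)(\gamma)=r\cdot_TG(\gamma)$; $(F+_pG)(\gamma)=F(\gamma)+_pG(\gamma)$. Types: $\mathcal S[\![b]\!]=[\![b]\!]$, $\mathcal S[\![\mathtt{Unit}]\!]=\{*\}$, $\mathcal S[\![\sigma\times\tau]\!]=\mathcal S[\![\sigma]\!]\times\mathcal S[\![\tau]\!]$, $\mathcal S[\![\sigma\to\tau]\!]=\mathcal S[\![\sigma]\!]\to S(\mathcal S[\![\tau]\!])$. A term $\Gamma\vdash M:\sigma$ denotes $\mathcal S[\![M]\!]:\mathcal S[\![\Gamma]\!]\to S(\mathcal S[\![\sigma]\!])$ by the standard left-to-right call-by-value monadic semantics: variables, constants, $*$ and abstractions via $\eta$ ($\mathcal S[\![\lambda x{:}\sigma.M]\!](\rho)=\eta(a\mapsto\mathcal S[\![M]\!](\rho,a))$); pairs, projections, applications, function symbols and conditions of conditionals by sequencing arguments left to right with Kleisli extension; $\mathtt{or}$ and $+_p$ by applying the corresponding operation of $S$ to the denotations of the arguments; $\mathcal S[\![N\cdot M]\!](\rho)=(r\mapsto r\cdot\mathcal S[\![M]\!](\rho))^\dagger(\mathcal S[\![N]\!](\rho))$. **Equational logic.** Assertions are $\Gamma\vdash M=N:\sigma$ and purity assertions $\Gamma\vdash M\downarrow_\sigma$, for terms of type $\sigma$ in $\Gamma$. The first is true in $\mathcal S_T$ if $\mathcal S[\![M]\!]=\mathcal S[\![N]\!]$; the second if for every $\rho\in\mathcal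 S[\![\Gamma]\!]$ there is $a\in\mathcal S[\![\sigma]\!]$ with $\mathcal S[\![M]\!](\rho)=\eta(a)$; truth is written $\models_{\mathcal S_T}$. A theory is a set $\mathrm{Ax}$ of assertions; it is valid in $\mathcal S_T$ if all its members are true in $\mathcal S_T$. $\vdash_{\mathrm{Ax}}$ is derivability from $\mathrm{Ax}$ by the following (Moggi's computational $\lambda$-calculus, extended to this language). *Rules*: $=$ is an equivalence relation and a congruence for all term constructors; if $M=N$ and $M\downarrow$ then $N\downarrow$; weakening; if $\Gamma\vdash M\downarrow_\sigma$ and an assertion $A$ is derivable in $\Gamma,x{:}\sigma$ then $A[M/x]$ is derivable in $\Gamma$. *Purity*: $x\downarrow$, $c\downarrow$, $*\downarrow$, $(\lambda x{:}\sigma.M)\downarrow$, $\langle x,y\rangle\downarrow$, $\mathtt{fst}(x)\downarrow$, $\mathtt{snd}(x)\downarrow$. *Let*: $\mathtt{let}\,x\,\mathtt{be}\,M\,\mathtt{in}\,x=M$; $\mathtt{let}\,x_2\,\mathtt{be}\,(\mathtt{let}\,x_1\,\mathtt{be}\,M_1\,\mathtt{in}\,M_2)\,\mathtt{in}\,N=\mathtt{let}\,x_1\,\mathtt{be}\,M_1\,\mathtt{in}\,\mathtt{let}\,x_2\,\mathtt{be}\,M_2\,\mathtt{in}\,N$ ($x_1\notin FV(N)$). *Evaluation order* (fresh variables): $MN=\mathtt{let}\,x\,\mathtt{be}\,M\,\mathtt{in}\,\mathtt{let}\,y\,\mathtt{be}\,N\,\mathtt{in}\,xy$, and likewise for pairs,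 projections, function symbol applications (left to right) and the condition of a conditional. *Structural*: $(\lambda x{:}\sigma.M)x=M$; $\lambda x{:}\sigma.\,yx=y$; $\mathtt{fst}\langle x,y\rangle=x$; $\mathtt{snd}\langle x,y\rangle=y$; $\langle\mathtt{fst}(x),\mathtt{snd}(x)\rangle=x$; $x=*$ for $x:\mathtt{Unit}$. *Conditionals*: $\mathtt{if}\,\mathtt{tt}\,\mathtt{then}\,M\,\mathtt{else}\,N=M$; $\mathtt{if}\,\mathtt{ff}\,\mathtt{then}\,M\,\mathtt{else}\,N=N$; $u(x)=\mathtt{if}\,x\,\mathtt{then}\,u(\mathtt{tt})\,\mathtt{else}\,u(\mathtt{ff})$. *Function symbols*: $f(c_1,\dots,c_m)=\mathrm{val}_f(c_1,\dots,c_m)$. *Algebraic operations* ($u$ a variable of function type): $u(M\,\mathtt{or}\,N)=u(M)\,\mathtt{or}\,u(N)$; $u(M+_pN)=u(M)+_pu(N)$; $u(y\cdot M)=y\cdot u(M)$; $N\cdot M=\mathtt{let}\,y{:}\mathtt{Rew}\,\mathtt{be}\,N\,\mathtt{in}\,y\cdot M$ ($y\notin FV(M)$). **The axioms $\mathrm{Ax}_1$** ($L,M,N,P$ terms of a common type, $x,y$ variables of type $\mathtt{Rew}$): $M\,\mathtt{or}\,M=M$; $(L\,\mathtt{or}\,M)\,\mathtt{or}\,N=L\,\mathtt{or}\,(M\,\mathtt{or}\,N)$; $0\cdot N=N$; $x\cdot(y\cdot N)=(x+y)\cdot N$; $M+_1N=M$; $M+_pN=N+_{1-p}M$; $(M+_pN)+_qP=M+_{pq}(N+_{(1-p)q/(1-pq)}P)$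 ($p,q<1$); $M+_pM=M$; $x\cdot(M+_pN)=x\cdot M+_px\cdot N$; $x\cdot(M\,\mathtt{or}\,N)=(x\cdot M)\,\mathtt{or}\,(x\cdot N)$; $L+_p(M\,\mathtt{or}\,N)=(L+_pM)\,\mathtt{or}\,(L+_pN)$; and, for $M,N$ in expectation PR-form over the same $L_1,\dots,L_m$ with the same outer weights, $\mathtt{if}\,\mathrm E_s(M)\ge\mathrm E_s(N)\,\mathtt{then}\,M\,\mathtt{else}\,N=M\,\mathtt{or}\,N$ and $\mathtt{if}\,\mathrm E_s(M)\ge\mathrm E_s(N)\,\mathtt{then}\,(M\,\mathtt{or}\,P)\,\mathtt{else}\,(P\,\mathtt{or}\,N)=(M\,\mathtt{or}\,P)\,\mathtt{or}\,N$. Here $M$ is in expectation PR-form over $L_1,\dots,L_m$, with outer weights $p_1,\dots,p_m$, if it has the form $\sum_{i=1}^mp_i\sum_{j=1}^{n_i}q_{ij}(M_{ij}\cdot L_i)$ (iterated uses of the $+_p$; $p_i,q_{ij}\in[0,1]$, $\sum_ip_i=1$, $\sum_jq_{ij}=1$) where the $M_{ij}$ are variables or constants of type $\mathtt{Rew}$; then $\mathrm E_s(M)$ is the term $\bigoplus_ip_i\bigoplus_jq_{ij}M_{ij}$ of type $\mathtt{Rew}$ (the corresponding iterated uses of the $\oplus_p$). **Purity completeness for PR-effect values.** PR-effect values of base type $b$ are the programs generated by $E::=c\mid d\cdot E\mid E_1+_pE_2$ with $c:b$, $d:\mathtt{Rew}$ constants. A theory $\mathrm{Ax}$ valid in $\mathcal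 S_T$ is strongly purity complete for basic PR-effect values if for every base type $b$ and PR-effect value $E:b$: $\models_{\mathcal S_T}E\downarrow_b$ implies $\vdash_{\mathrm{Ax}}E=c:b$ for some constant $c:b$. -}

module Defs where

open import Level using (0ℓ)
open import Algebra.Bundles using (Ring)
open import Algebra.Structures using (IsCommutativeRing; IsCommutativeMonoid)
import Algebra.Properties.Ring as RingProperties
open import Data.Bool.Base using (Bool; true; false; if_then_else_)
open import Data.Empty using (⊥-elim)
open import Data.List.Base using (List; []; _∷_)
open import Data.List.Membership.Propositional using (_∈_)
open import Data.List.Relation.Binary.Subset.Propositional using (_⊆_)
open import Data.List.Relation.Binary.Subset.Propositional.Properties using (∷⁺ʳ)
open import Data.List.Relation.Unary.All as All using (All; []; _∷_; lookup)
open import Data.List.Relation.Unary.Any using (here; there)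
open import Data.Nat.Base using (ℕ; zero; suc)
open import Data.Product.Base using (Σ; ∃; ∃₂; _×_; _,_; proj₁; proj₂)
open import Data.Sum.Base using (inj₁; inj₂)
open import Data.Unit.Base using (⊤; tt)
open import Data.Vec.Base using (Vec; []; _∷_; map; zipWith)
open import Function.Base using (_∘_; id)
open import Function.Bundles using (_⇔_)
open import Relation.Binary.Core using (Rel)
open import Relation.Binary.PropositionalEquality
  using (_≡_; _≢_; refl; sym; trans; cong; cong₂; subst; subst₂)
import Relation.Binary.Construct.NonStrictToStrict as Strict
open import Relation.Binary.Structures using (IsDecTotalOrder)
open import Relation.Nullary.Decidable.Core using (does; yes; no; recompute)
open import Relation.Unary using (Pred)

-- The library has no real numbers, so they enter through their
-- characterisation as the Dedekind-complete ordered field, which is unique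
-- up to isomorphism.  The order is decidable because the development is
-- classical.  The value of 0# ⁻¹ is unspecified.

record Reals : Set₁ where
  infixl 6 _+_
  infixl 7 _*_
  infix  8 -_
  infix  9 _⁻¹
  infix  4 _≤_
  field
    ℝ     : Set
    _+_   : ℝ → ℝ → ℝ
    _*_   : ℝ → ℝ → ℝ
    -_    : ℝ → ℝ
    _⁻¹   : ℝ → ℝ
    0#    : ℝ
    1#    : ℝ
    _≤_   : Rel ℝ 0ℓ
    isCommutativeRing : IsCommutativeRing _≡_ _+_ _*_ -_ 0# 1#
    0≢1               : 0# ≢ 1#
    *-inverseʳ        : ∀ x → x ≢ 0# → x * x ⁻¹ ≡ 1#
    isDecTotalOrder   : IsDecTotalOrder _≡_ _≤_
    +-monoˡ-≤         : ∀ z {x y} → x ≤ y → x + z ≤ y + z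
    *-nonNeg          : ∀ {x y} → 0# ≤ x → 0# ≤ y → 0# ≤ x * y

  UpperBound : Pred ℝ 0ℓ → ℝ → Set
  UpperBound P u = ∀ x → P x → x ≤ u

  field
    sup : ∀ (P : Pred ℝ 0ℓ) → ∃ P → ∃ (UpperBound P) →
          ∃ λ s → UpperBound P s × (∀ u → UpperBound P u → s ≤ u)

  open Strict _≡_ _≤_ public using (_<_)
  open IsCommutativeRing isCommutativeRing public
    using ( +-assoc; +-comm; +-identityˡ; +-identityʳ; -‿inverseˡ; -‿inverseʳ
          ; *-assoc; *-comm; *-identityˡ; *-identityʳ; distribˡ; distribʳ
          ; zeroˡ; zeroʳ; isRing)
  open IsDecTotalOrder isDecTotalOrder public
    using (_≟_; _≤?_)
    renaming ( total to ≤-total; antisym to ≤-antisym; trans to ≤-trans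
             ; refl to ≤-refl; reflexive to ≤-reflexive)

  infixl 6 _-_
  _-_ : ℝ → ℝ → ℝ
  x - y = x + (- y)

module RealLemmas (𝓡 : Reals) where
  open Reals 𝓡

  ring : Ring 0ℓ 0ℓ
  ring = record { isRing = isRing }

  open RingProperties ring using (-‿distribʳ-*; -‿distribˡ-*; -‿involutive)

  x≤y⇒0≤y-x : ∀ {x y} → x ≤ y → 0# ≤ y - x
  x≤y⇒0≤y-x {x} {y} x≤y = subst (_≤ y - x) (-‿inverseʳ x) (+-monoˡ-≤ (- x) x≤y)

  y-x+x≡y : ∀ x y → (y - x) + x ≡ y
  y-x+x≡y x y =
    trans (+-assoc y (- x) x) (trans (cong (y +_) (-‿inverseˡ x)) (+-identityʳ y))

  0≤y-x⇒x≤y : ∀ {x y} → 0# ≤ y - x → x ≤ y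
  0≤y-x⇒x≤y {x} {y} p =
    subst₂ _≤_ (+-identityˡ x) (y-x+x≡y x y) (+-monoˡ-≤ x p)

  +-nonNeg : ∀ {x y} → 0# ≤ x → 0# ≤ y → 0# ≤ x + y
  +-nonNeg {x} {y} 0≤x 0≤y =
    ≤-trans 0≤y (subst (_≤ x + y) (+-identityˡ y) (+-monoˡ-≤ y 0≤x))

  x≤x+y : ∀ {x y} → 0# ≤ y → x ≤ x + y
  x≤x+y {x} {y} 0≤y =
    subst₂ _≤_ (+-identityˡ x) (+-comm y x) (+-monoˡ-≤ x 0≤y)

  x≤0⇒0≤-x : ∀ {x} → x ≤ 0# → 0# ≤ - x
  x≤0⇒0≤-x {x} x≤0 = subst (0# ≤_) (+-identityˡ (- x)) (x≤y⇒0≤y-x x≤0)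

  *-monoˡ-≤ : ∀ {x y z} → 0# ≤ z → x ≤ y → z * x ≤ z * y
  *-monoˡ-≤ {x} {y} {z} 0≤z x≤y = 0≤y-x⇒x≤y (subst (0# ≤_)
    (trans (distribˡ z y (- x)) (cong (z * y +_) (sym (-‿distribʳ-* z x))))
    (*-nonNeg 0≤z (x≤y⇒0≤y-x x≤y)))

  0≤1 : 0# ≤ 1#
  0≤1 with ≤-total 0# 1#
  ... | inj₁ p = p
  ... | inj₂ p = subst (0# ≤_)
    (trans (sym (-‿distribˡ-* 1# (- 1#)))
      (trans (cong -_ (*-identityˡ (- 1#))) (-‿involutive 1#)))
    (*-nonNeg (x≤0⇒0≤-x p) (x≤0⇒0≤-x p))

  ⁻¹-nonNeg : ∀ {c} → 0# ≤ c → c ≢ 0# → 0# ≤ c ⁻¹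
  ⁻¹-nonNeg {c} 0≤c c≢0 with ≤-total 0# (c ⁻¹)
  ... | inj₁ p = p
  ... | inj₂ p = ⊥-elim (0≢1 (≤-antisym 0≤1 1≤0))
    where
    0≤-1 : 0# ≤ - 1#
    0≤-1 = subst (0# ≤_)
      (trans (sym (-‿distribʳ-* c (c ⁻¹))) (cong -_ (*-inverseʳ c c≢0)))
      (*-nonNeg 0≤c (x≤0⇒0≤-x p))
    1≤0 : 1# ≤ 0#
    1≤0 = 0≤y-x⇒x≤y (subst (0# ≤_) (sym (+-identityˡ (- 1#))) 0≤-1)

module UnitInterval (𝓡 : Reals) where
  open Reals 𝓡
  open RealLemmas 𝓡

  -- The bounds are irrelevant, so that 𝕀 is a subset of ℝ.
  record 𝕀 : Set where
    constructor mk𝕀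
    field
      val    : ℝ
      .0≤val : 0# ≤ val
      .val≤1 : val ≤ 1#
  open 𝕀 public using (val)

  0≤val : ∀ p → 0# ≤ val p
  0≤val (mk𝕀 v 0≤v _) = recompute (0# ≤? v) 0≤v

  val≤1 : ∀ p → val p ≤ 1#
  val≤1 (mk𝕀 v _ v≤1) = recompute (v ≤? 1#) v≤1

  IsInterior : 𝕀 → Set
  IsInterior p = 0# < val p × val p < 1#

  1𝕀 : 𝕀
  1𝕀 = mk𝕀 1# 0≤1 ≤-refl

  1-_ : 𝕀 → 𝕀
  1- p = mk𝕀 (1# - val p) (x≤y⇒0≤y-x (val≤1 p))
    (0≤y-x⇒x≤y (subst (0# ≤_) (sym eq) (0≤val p)))
    where
    open RingProperties ring using (-‿involutive; -‿+-comm)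
    eq : 1# - (1# - val p) ≡ val p
    eq = trans (cong (1# +_) (trans (sym (-‿+-comm 1# (- val p)))
                                    (cong ((- 1#) +_) (-‿involutive (val p)))))
        (trans (sym (+-assoc 1# (- 1#) (val p)))
        (trans (cong (_+ val p) (-‿inverseʳ 1#)) (+-identityˡ (val p))))

  *≤ʳ : ∀ p q → val p * val q ≤ val q
  *≤ʳ p q = subst₂ _≤_ (*-comm (val q) (val p)) (*-identityʳ (val q))
    (*-monoˡ-≤ (0≤val q) (val≤1 p))

  _*𝕀_ : 𝕀 → 𝕀 → 𝕀
  p *𝕀 q = mk𝕀 (val p * val q) (*-nonNeg (0≤val p) (0≤val q))
    (≤-trans (*≤ʳ p q) (val≤1 q))

  ratio : ∀ a c → .(0# ≤ a) → .(a ≤ c) → .(c ≢ 0#) → 𝕀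
  ratio a c 0≤a a≤c c≢0 = mk𝕀 (a * c ⁻¹) (*-nonNeg 0≤a (0≤c⁻¹ 0≤a a≤c c≢0))
    (subst₂ _≤_ (*-comm (c ⁻¹) a) (trans (*-comm (c ⁻¹) c) (*-inverseʳ c c≢0))
      (*-monoˡ-≤ (0≤c⁻¹ 0≤a a≤c c≢0) a≤c))
    where
    0≤c⁻¹ : 0# ≤ a → a ≤ c → c ≢ 0# → 0# ≤ c ⁻¹
    0≤c⁻¹ 0≤a a≤c = ⁻¹-nonNeg (≤-trans 0≤a a≤c)

  [1-p]q≤1-pq : ∀ p q → val (1- p) * val q ≤ 1# - val p * val q
  [1-p]q≤1-pq p q = subst (_≤ 1# - val p * val q) eq
    (+-monoˡ-≤ (- (val p * val q)) (val≤1 q))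
    where
    open RingProperties ring using (-‿distribˡ-*)
    eq : val q - val p * val q ≡ (1# - val p) * val q
    eq = sym (trans (distribʳ (val q) 1# (- val p))
      (cong₂ _+_ (*-identityˡ (val q)) (sym (-‿distribˡ-* (val p) (val q)))))

  1-pq≢0 : ∀ p q → val q < 1# → 1# - val p * val q ≢ 0#
  1-pq≢0 p q (q≤1 , q≢1) 1-pq≡0 = q≢1 (≤-antisym q≤1 (subst (_≤ val q) pq≡1 (*≤ʳ p q)))
    where
    pq≡1 : val p * val q ≡ 1#
    pq≡1 = trans (sym (+-identityˡ _))
      (trans (cong (_+ val p * val q) (sym 1-pq≡0)) (y-x+x≡y (val p * val q) 1#))

  -- (1-p)q / (1-pq)
  reweigh : ∀ p q → .(val p < 1#) → .(val q < 1#) → 𝕀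
  reweigh p q p<1 q<1 = ratio (val (1- p) * val q) (1# - val p * val q)
    (*-nonNeg (0≤val (1- p)) (0≤val q)) ([1-p]q≤1-pq p q) (1-pq≢0 p q q<1)

  sum : ∀ {n} → Vec 𝕀 n → ℝ
  sum []       = 0#
  sum (p ∷ ps) = val p + sum ps

  0≤sum : ∀ {n} (ps : Vec 𝕀 n) → 0# ≤ sum ps
  0≤sum []       = ≤-refl
  0≤sum (p ∷ ps) = +-nonNeg (0≤val p) (0≤sum ps)

  -- Weights n consists of n + 1 weights: no empty family has sum 1.
  record Weights (n : ℕ) : Set where
    constructor mkWeights
    field
      weights : Vec 𝕀 (suc n)
      .sum≡1  : sum weights ≡ 1#
  open Weights public using (weights)

  -- Iterated binary sums, associated to the right.  For weights of sum 1
  -- this is the recursion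
  --   ∑ᵢ pᵢ xᵢ = x₁                                if p₁ = 1,
  --   ∑ᵢ pᵢ xᵢ = x₁ +_{p₁} ∑_{i≥2} (pᵢ/(1-p₁)) xᵢ  otherwise,
  -- with the successive renormalisations carried out in place: the i-th
  -- binary sum has weight pᵢ/(pᵢ + ⋯ + pₙ).
  module _ {A : Set} (_+[_]_ : A → 𝕀 → A → A) where

    iterate : ∀ {n} → Vec 𝕀 (suc n) → Vec A (suc n) → A
    iterate {zero}  (_ ∷ [])  (x ∷ [])  = x
    iterate {suc n} (p ∷ ps)  (x ∷ xs) with sum ps ≟ 0#
    ... | yes _   = x
    ... | no ∑≢0 = x +[ ratio (val p) (val p + sum ps) (0≤val p) (x≤x+y (0≤sum ps)) ≢0 ] iterate ps xs
      where
      ≢0 : val p + sum ps ≢ 0#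
      ≢0 eq = ∑≢0 (≤-antisym
        (subst (sum ps ≤_) (trans (+-comm (sum ps) (val p)) eq) (x≤x+y (0≤val p)))
        (0≤sum ps))

    ∑ : ∀ {n} → Weights n → Vec A (suc n) → A
    ∑ w = iterate (weights w)

module _ (𝓡 : Reals) where
  open UnitInterval 𝓡

  record IsBarycentric {A : Set} (_+[_]_ : A → 𝕀 → A → A) : Set where
    field
      unit  : ∀ x y → x +[ 1𝕀 ] y ≡ x
      idem  : ∀ p x → x +[ p ] x ≡ x
      comm  : ∀ p x y → x +[ p ] y ≡ y +[ 1- p ] x
      assoc : ∀ p q .(p<1 : Reals._<_ 𝓡 (val p) (Reals.1# 𝓡))
                    .(q<1 : Reals._<_ 𝓡 (val q) (Reals.1# 𝓡)) x y z →
              (x +[ p ] y) +[ q ] z ≡ x +[ p *𝕀 q ] (y +[ reweigh p q p<1 q<1 ] z)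

  record Rewards : Set₁ where
    infixl 6 _+_
    infix  5 _+[_]_
    infix  4 _≤_
    field
      R       : Set
      _+[_]_  : R → 𝕀 → R → R
      _+_     : R → R → R
      0#      : R
      _≤_     : Rel R 0ℓ
      isBarycentric       : IsBarycentric _+[_]_
      isCommutativeMonoid : IsCommutativeMonoid _≡_ _+_ 0#
      +-distribˡ          : ∀ p r s s′ → r + (s +[ p ] s′) ≡ (r + s) +[ p ] (r + s′)
      isDecTotalOrder     : IsDecTotalOrder _≡_ _≤_
      +-≤-⇔     : ∀ r s t → (r ≤ s) ⇔ (r + t ≤ s + t)
      +[]-≤-⇔   : ∀ p → IsInterior p → ∀ r s t → (r ≤ s) ⇔ (r +[ p ] t ≤ s +[ p ] t)

    open IsDecTotalOrder isDecTotalOrder public using (_≤?_)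
    open Strict _≡_ _≤_ public using (_<_)

    ConditionC : Set
    ConditionC = ∀ p → IsInterior p → ∀ s → s < 0# →
                 ∃₂ λ l r → l < s + (r +[ p ] l)

data Base (B : Set) : Set where
  bool rew : Base B
  other    : B → Base B

record Signature (𝓡 : Reals) : Set₁ where
  open UnitInterval 𝓡
  field
    OtherBase : Set

  BaseType : Set
  BaseType = Base OtherBase

  field
    Con  : BaseType → Set
    ttᶜ  : Con bool
    ffᶜ  : Con bool
    0ᶜ   : Con rew
    Fun  : List BaseType → BaseType → Set
    eqᶠ  : ∀ b → Fun (b ∷ b ∷ []) bool
    +ᶠ   : Fun (rew ∷ rew ∷ []) rew
    ⊕ᶠ   : 𝕀 → Fun (rew ∷ rew ∷ []) rew
    ≤ᶠ   : Fun (rew ∷ rew ∷ []) bool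
    valᶠ : ∀ {bs b} → Fun bs b → All Con bs → Con b
    val-eq-≡ : ∀ {b} (c : Con b) → valᶠ (eqᶠ b) (c ∷ c ∷ []) ≡ ttᶜ
    val-eq-≢ : ∀ {b} (c c′ : Con b) → c ≢ c′ → valᶠ (eqᶠ b) (c ∷ c′ ∷ []) ≡ ffᶜ

-- Terms are intrinsically typed, with de Bruijn indices; this accounts for
-- α-equivalence and for the freshness conditions.

module Language (𝓡 : Reals) (Sig : Signature 𝓡) where
  open UnitInterval 𝓡 public
  open Signature Sig public

  infixr 7 _⇒_
  infixr 8 _⊗_
  data Type : Set where
    base : BaseType → Type
    unit : Type
    _⊗_  : Type → Type → Type
    _⇒_  : Type → Type → Type

  Ctx : Set
  Ctx = List Type

  infixl 5 _or_
  infixl 5 _+[_]_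
  infixr 6 _·_

  data Tm (Γ : Ctx) : Type → Set where
    var    : ∀ {σ} → σ ∈ Γ → Tm Γ σ
    con    : ∀ {b} → Con b → Tm Γ (base b)
    fun    : ∀ {bs b} → Fun bs b → All (λ b′ → Tm Γ (base b′)) bs → Tm Γ (base b)
    ite    : ∀ {σ} → Tm Γ (base bool) → Tm Γ σ → Tm Γ σ → Tm Γ σ
    _or_   : ∀ {σ} → Tm Γ σ → Tm Γ σ → Tm Γ σ
    _·_    : ∀ {σ} → Tm Γ (base rew) → Tm Γ σ → Tm Γ σ
    _+[_]_ : ∀ {σ} → Tm Γ σ → 𝕀 → Tm Γ σ → Tm Γ σ
    ⋆      : Tm Γ unit
    pair   : ∀ {σ τ} → Tm Γ σ → Tm Γ τ → Tm Γ (σ ⊗ τ)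
    fst    : ∀ {σ τ} → Tm Γ (σ ⊗ τ) → Tm Γ σ
    snd    : ∀ {σ τ} → Tm Γ (σ ⊗ τ) → Tm Γ τ
    lam    : ∀ {σ τ} → Tm (σ ∷ Γ) τ → Tm Γ (σ ⇒ τ)
    app    : ∀ {σ τ} → Tm Γ (σ ⇒ τ) → Tm Γ σ → Tm Γ τ

  Args : Ctx → List BaseType → Set
  Args Γ = All (λ b → Tm Γ (base b))

  Program : Type → Set
  Program = Tm []

  mutual
    ren : ∀ {Γ Δ σ} → Γ ⊆ Δ → Tm Γ σ → Tm Δ σ
    ren f (var x)        = var (f x)
    ren f (con c)        = con c
    ren f (fun g Ms)     = fun g (renArgs f Ms)
    ren f (ite L M N)    = ite (ren f L) (ren f M) (ren f N)
    ren f (M or N)       = ren f M or ren f N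
    ren f (N · M)        = ren f N · ren f M
    ren f (M +[ p ] N)   = ren f M +[ p ] ren f N
    ren f ⋆              = ⋆
    ren f (pair M N)     = pair (ren f M) (ren f N)
    ren f (fst M)        = fst (ren f M)
    ren f (snd M)        = snd (ren f M)
    ren f (lam {σ} M)    = lam (ren (∷⁺ʳ σ f) M)
    ren f (app M N)      = app (ren f M) (ren f N)

    renArgs : ∀ {Γ Δ bs} → Γ ⊆ Δ → Args Γ bs → Args Δ bs
    renArgs f []       = []
    renArgs f (M ∷ Ms) = ren f M ∷ renArgs f Ms

  wk : ∀ {Γ σ τ} → Tm Γ σ → Tm (τ ∷ Γ) σ
  wk = ren there

  Subst : Ctx → Ctx → Set
  Subst Γ Δ = ∀ {σ} → σ ∈ Γ → Tm Δ σ

  liftˢ : ∀ {Γ Δ τ} → Subst Γ Δ → Subst (τ ∷ Γ) (τ ∷ Δ)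
  liftˢ θ (here eq) = var (here eq)
  liftˢ θ (there x) = wk (θ x)

  mutual
    sub : ∀ {Γ Δ σ} → Subst Γ Δ → Tm Γ σ → Tm Δ σ
    sub θ (var x)        = θ x
    sub θ (con c)        = con c
    sub θ (fun g Ms)     = fun g (subArgs θ Ms)
    sub θ (ite L M N)    = ite (sub θ L) (sub θ M) (sub θ N)
    sub θ (M or N)       = sub θ M or sub θ N
    sub θ (N · M)        = sub θ N · sub θ M
    sub θ (M +[ p ] N)   = sub θ M +[ p ] sub θ N
    sub θ ⋆              = ⋆
    sub θ (pair M N)     = pair (sub θ M) (sub θ N)
    sub θ (fst M)        = fst (sub θ M)
    sub θ (snd M)        = snd (sub θ M)
    sub θ (lam M)        = lam (sub (liftˢ θ) M)
    sub θ (app M N)      = app (sub θ M) (sub θ N)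

    subArgs : ∀ {Γ Δ bs} → Subst Γ Δ → Args Γ bs → Args Δ bs
    subArgs θ []       = []
    subArgs θ (M ∷ Ms) = sub θ M ∷ subArgs θ Ms

  single : ∀ {Γ τ} → Tm Γ τ → Subst (τ ∷ Γ) Γ
  single M (here refl) = M
  single M (there x)   = var x

  infix 9 _[_]
  _[_] : ∀ {Γ σ τ} → Tm (τ ∷ Γ) σ → Tm Γ τ → Tm Γ σ
  N [ M ] = sub (single M) N

  v₀ : ∀ {Γ σ} → Tm (σ ∷ Γ) σ
  v₀ = var (here refl)

  v₁ : ∀ {Γ σ τ} → Tm (τ ∷ σ ∷ Γ) σ
  v₁ = var (there (here refl))

  -- let x be M in N
  lett : ∀ {Γ σ τ} → Tm Γ σ → Tm (σ ∷ Γ) τ → Tm Γ τ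
  lett M N = app (lam N) M

  -- let x₁ be M₁ in … let xₘ be Mₘ in N
  infixl 5 _▷_
  _▷_ : Ctx → List BaseType → Ctx
  Γ ▷ []       = Γ
  Γ ▷ (b ∷ bs) = (base b ∷ Γ) ▷ bs

  lets : ∀ {Γ bs τ} → Args Γ bs → Tm (Γ ▷ bs) τ → Tm Γ τ
  lets []       N = N
  lets (M ∷ Ms) N = lett M (lets (renArgs there Ms) N)

  thereAll : ∀ {Γ σ} bs → σ ∈ Γ → σ ∈ (Γ ▷ bs)
  thereAll []       x = x
  thereAll (b ∷ bs) x = thereAll bs (there x)

  letVars : ∀ {Γ} bs → Args (Γ ▷ bs) bs
  letVars []       = []
  letVars (b ∷ bs) = var (thereAll bs (here refl)) ∷ letVars bs

  infix 4 _≐_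
  infix 4 _↓
  data Assertion (Γ : Ctx) : Set where
    _≐_ : ∀ {σ} → Tm Γ σ → Tm Γ σ → Assertion Γ
    _↓  : ∀ {σ} → Tm Γ σ → Assertion Γ

  renᴬ : ∀ {Γ Δ} → Γ ⊆ Δ → Assertion Γ → Assertion Δ
  renᴬ f (M ≐ N) = ren f M ≐ ren f N
  renᴬ f (M ↓)   = ren f M ↓

  infix 9 _[_]ᴬ
  _[_]ᴬ : ∀ {Γ τ} → Assertion (τ ∷ Γ) → Tm Γ τ → Assertion Γ
  (N ≐ N′) [ M ]ᴬ = N [ M ] ≐ N′ [ M ]
  (N ↓)    [ M ]ᴬ = N [ M ] ↓

  Theory : Set₁
  Theory = ∀ Γ → Pred (Assertion Γ) 0ℓ

  infix 4 _⊑_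
  _⊑_ : Theory → Theory → Set
  Ax ⊑ Ax′ = ∀ {Γ} (A : Assertion Γ) → Ax Γ A → Ax′ Γ A

  infix 3 _⊢_ _⊢*_≐_

  mutual
    data _⊢_ (Ax : Theory) : ∀ {Γ} → Assertion Γ → Set where
      axiom : ∀ {Γ} {A : Assertion Γ} → Ax Γ A → Ax ⊢ A

      -- Contexts are lists here, so weakening is stated for an
      -- arbitrary renaming, which includes exchange.
      ≐-refl  : ∀ {Γ σ} {M : Tm Γ σ} → Ax ⊢ M ≐ M
      ≐-sym   : ∀ {Γ σ} {M N : Tm Γ σ} → Ax ⊢ M ≐ N → Ax ⊢ N ≐ M
      ≐-trans : ∀ {Γ σ} {L M N : Tm Γ σ} → Ax ⊢ L ≐ M → Ax ⊢ M ≐ N → Ax ⊢ L ≐ N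
      cong-fun  : ∀ {Γ bs b} (f : Fun bs b) {Ms Ns : Args Γ bs} →
                  Ax ⊢* Ms ≐ Ns → Ax ⊢ fun f Ms ≐ fun f Ns
      cong-ite  : ∀ {Γ σ} {L L′} {M M′ N N′ : Tm Γ σ} →
                  Ax ⊢ L ≐ L′ → Ax ⊢ M ≐ M′ → Ax ⊢ N ≐ N′ →
                  Ax ⊢ ite L M N ≐ ite L′ M′ N′
      cong-or   : ∀ {Γ σ} {M M′ N N′ : Tm Γ σ} →
                  Ax ⊢ M ≐ M′ → Ax ⊢ N ≐ N′ → Ax ⊢ (M or N) ≐ (M′ or N′)
      cong-·    : ∀ {Γ σ} {N N′} {M M′ : Tm Γ σ} →
                  Ax ⊢ N ≐ N′ → Ax ⊢ M ≐ M′ → Ax ⊢ (N · M) ≐ (N′ · M′)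
      cong-+[]  : ∀ {Γ σ} p {M M′ N N′ : Tm Γ σ} →
                  Ax ⊢ M ≐ M′ → Ax ⊢ N ≐ N′ → Ax ⊢ (M +[ p ] N) ≐ (M′ +[ p ] N′)
      cong-pair : ∀ {Γ σ τ} {M M′ : Tm Γ σ} {N N′ : Tm Γ τ} →
                  Ax ⊢ M ≐ M′ → Ax ⊢ N ≐ N′ → Ax ⊢ pair M N ≐ pair M′ N′
      cong-fst  : ∀ {Γ σ τ} {M M′ : Tm Γ (σ ⊗ τ)} → Ax ⊢ M ≐ M′ → Ax ⊢ fst M ≐ fst M′
      cong-snd  : ∀ {Γ σ τ} {M M′ : Tm Γ (σ ⊗ τ)} → Ax ⊢ M ≐ M′ → Ax ⊢ snd M ≐ snd M′
      cong-lam  : ∀ {Γ σ τ} {M M′ : Tm (σ ∷ Γ) τ} → Ax ⊢ M ≐ M′ → Ax ⊢ lam M ≐ lam M′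
      cong-app  : ∀ {Γ σ τ} {M M′ : Tm Γ (σ ⇒ τ)} {N N′ : Tm Γ σ} →
                  Ax ⊢ M ≐ M′ → Ax ⊢ N ≐ N′ → Ax ⊢ app M N ≐ app M′ N′
      ↓-resp-≐  : ∀ {Γ σ} {M N : Tm Γ σ} → Ax ⊢ M ≐ N → Ax ⊢ M ↓ → Ax ⊢ N ↓
      weakening : ∀ {Γ Δ} {A : Assertion Γ} (f : Γ ⊆ Δ) → Ax ⊢ A → Ax ⊢ renᴬ f A
      substitution : ∀ {Γ σ} {M : Tm Γ σ} {A : Assertion (σ ∷ Γ)} →
                     Ax ⊢ M ↓ → Ax ⊢ A → Ax ⊢ A [ M ]ᴬ

      var-↓  : ∀ {Γ σ} (x : σ ∈ Γ) → Ax ⊢ var x ↓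
      con-↓  : ∀ {Γ b} (c : Con b) → Ax ⊢ con {Γ} c ↓
      ⋆-↓    : ∀ {Γ} → Ax ⊢ ⋆ {Γ} ↓
      lam-↓  : ∀ {Γ σ τ} (M : Tm (σ ∷ Γ) τ) → Ax ⊢ lam M ↓
      pair-↓ : ∀ {Γ σ τ} (x : σ ∈ Γ) (y : τ ∈ Γ) → Ax ⊢ pair (var x) (var y) ↓
      fst-↓  : ∀ {Γ σ τ} (x : σ ⊗ τ ∈ Γ) → Ax ⊢ fst (var x) ↓
      snd-↓  : ∀ {Γ σ τ} (x : σ ⊗ τ ∈ Γ) → Ax ⊢ snd (var x) ↓

      let-var   : ∀ {Γ σ} (M : Tm Γ σ) → Ax ⊢ lett M v₀ ≐ M
      let-assoc : ∀ {Γ σ τ υ} (M₁ : Tm Γ σ) (M₂ : Tm (σ ∷ Γ) τ) (N : Tm (τ ∷ Γ) υ) →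
                  Ax ⊢ lett (lett M₁ M₂) N ≐ lett M₁ (lett M₂ (ren (∷⁺ʳ τ there) N))

      eval-app  : ∀ {Γ σ τ} (M : Tm Γ (σ ⇒ τ)) (N : Tm Γ σ) →
                  Ax ⊢ app M N ≐ lett M (lett (wk N) (app v₁ v₀))
      eval-pair : ∀ {Γ σ τ} (M : Tm Γ σ) (N : Tm Γ τ) →
                  Ax ⊢ pair M N ≐ lett M (lett (wk N) (pair v₁ v₀))
      eval-fst  : ∀ {Γ σ τ} (M : Tm Γ (σ ⊗ τ)) → Ax ⊢ fst M ≐ lett M (fst v₀)
      eval-snd  : ∀ {Γ σ τ} (M : Tm Γ (σ ⊗ τ)) → Ax ⊢ snd M ≐ lett M (snd v₀)
      eval-fun  : ∀ {Γ bs b} (f : Fun bs b) (Ms : Args Γ bs) →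
                  Ax ⊢ fun f Ms ≐ lets Ms (fun f (letVars bs))
      eval-ite  : ∀ {Γ σ} L (M N : Tm Γ σ) →
                  Ax ⊢ ite L M N ≐ lett L (ite v₀ (wk M) (wk N))

      -- By α-equivalence, β may be stated for a variable x
      -- other than the bound one.
      β-var   : ∀ {Γ σ τ} (M : Tm (σ ∷ Γ) τ) (x : σ ∈ Γ) →
                Ax ⊢ app (lam M) (var x) ≐ M [ var x ]
      η-⇒     : ∀ {Γ σ τ} (y : σ ⇒ τ ∈ Γ) → Ax ⊢ lam (app (wk (var y)) v₀) ≐ var y
      β-fst   : ∀ {Γ σ τ} (x : σ ∈ Γ) (y : τ ∈ Γ) →
                Ax ⊢ fst (pair (var x) (var y)) ≐ var x
      β-snd   : ∀ {Γ σ τ} (x : σ ∈ Γ) (y : τ ∈ Γ) →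
                Ax ⊢ snd (pair (var x) (var y)) ≐ var y
      η-⊗     : ∀ {Γ σ τ} (x : σ ⊗ τ ∈ Γ) →
                Ax ⊢ pair (fst (var x)) (snd (var x)) ≐ var x
      η-unit  : ∀ {Γ} (x : unit ∈ Γ) → Ax ⊢ var x ≐ ⋆

      ite-tt  : ∀ {Γ σ} (M N : Tm Γ σ) → Ax ⊢ ite (con ttᶜ) M N ≐ M
      ite-ff  : ∀ {Γ σ} (M N : Tm Γ σ) → Ax ⊢ ite (con ffᶜ) M N ≐ N
      ite-η   : ∀ {Γ σ} (u : base bool ⇒ σ ∈ Γ) (x : base bool ∈ Γ) →
                Ax ⊢ app (var u) (var x) ≐
                     ite (var x) (app (var u) (con ttᶜ)) (app (var u) (con ffᶜ))

      fun-val : ∀ {Γ bs b} (f : Fun bs b) (cs : All Con bs) →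
                Ax ⊢ fun {Γ} f (All.map con cs) ≐ con (valᶠ f cs)

      alg-or   : ∀ {Γ σ τ} (u : σ ⇒ τ ∈ Γ) M N →
                 Ax ⊢ app (var u) (M or N) ≐ (app (var u) M or app (var u) N)
      alg-+[]  : ∀ {Γ σ τ} (u : σ ⇒ τ ∈ Γ) p M N →
                 Ax ⊢ app (var u) (M +[ p ] N) ≐ (app (var u) M +[ p ] app (var u) N)
      alg-·    : ∀ {Γ σ τ} (u : σ ⇒ τ ∈ Γ) (y : base rew ∈ Γ) M →
                 Ax ⊢ app (var u) (var y · M) ≐ (var y · app (var u) M)
      ·-let    : ∀ {Γ σ} N (M : Tm Γ σ) → Ax ⊢ (N · M) ≐ lett N (v₀ · wk M)

    data _⊢*_≐_ (Ax : Theory) {Γ : Ctx} : ∀ {bs} → Args Γ bs → Args Γ bs → Set where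
      []  : Ax ⊢* [] ≐ []
      _∷_ : ∀ {b bs} {M N : Tm Γ (base b)} {Ms Ns : Args Γ bs} →
            Ax ⊢ M ≐ N → Ax ⊢* Ms ≐ Ns → Ax ⊢* (M ∷ Ms) ≐ (N ∷ Ns)

  data Atom (Γ : Ctx) : Set where
    var : base rew ∈ Γ → Atom Γ
    con : Con rew → Atom Γ

  ⌜_⌝ : ∀ {Γ} → Atom Γ → Tm Γ (base rew)
  ⌜ var x ⌝ = var x
  ⌜ con c ⌝ = con c

  -- The weights qᵢⱼ and rewards Mᵢⱼ, for a fixed i.
  record Inner (Γ : Ctx) : Set where
    field
      {size}  : ℕ
      q       : Weights size
      rewards : Vec (Atom Γ) (suc size)

  -- ∑ᵢ pᵢ ∑ⱼ qᵢⱼ (Mᵢⱼ · Lᵢ)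
  prForm : ∀ {Γ σ m} → Weights m → Vec (Tm Γ σ) (suc m) → Vec (Inner Γ) (suc m) → Tm Γ σ
  prForm p Ls Xs = ∑ _+[_]_ p (zipWith inner Ls Xs)
    where
    inner : Tm _ _ → Inner _ → Tm _ _
    inner L X = ∑ _+[_]_ (Inner.q X) (map (λ M → ⌜ M ⌝ · L) (Inner.rewards X))

  _⊕[_]_ : ∀ {Γ} → Tm Γ (base rew) → 𝕀 → Tm Γ (base rew) → Tm Γ (base rew)
  M ⊕[ p ] N = fun (⊕ᶠ p) (M ∷ N ∷ [])

  -- Eₛ p Xs is the expectation term of prForm p Ls Xs.
  Eₛ : ∀ {Γ m} → Weights m → Vec (Inner Γ) (suc m) → Tm Γ (base rew)
  Eₛ p Xs = ∑ _⊕[_]_ p (map (λ X → ∑ _⊕[_]_ (Inner.q X) (map ⌜_⌝ (Inner.rewards X))) Xs)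

  _≥ᵗ_ : ∀ {Γ} → Tm Γ (base rew) → Tm Γ (base rew) → Tm Γ (base bool)
  M ≥ᵗ N = fun ≤ᶠ (N ∷ M ∷ [])

  data Ax₁ (Γ : Ctx) : Assertion Γ → Set where
    or-idem   : ∀ {σ} (M : Tm Γ σ) → Ax₁ Γ ((M or M) ≐ M)
    or-assoc  : ∀ {σ} (L M N : Tm Γ σ) → Ax₁ Γ (((L or M) or N) ≐ (L or (M or N)))
    ·-zero    : ∀ {σ} (N : Tm Γ σ) → Ax₁ Γ ((con 0ᶜ · N) ≐ N)
    ·-·       : ∀ {σ} x y (N : Tm Γ σ) →
                Ax₁ Γ ((var x · (var y · N)) ≐ (fun +ᶠ (var x ∷ var y ∷ []) · N))
    +[]-unit  : ∀ {σ} (M N : Tm Γ σ) → Ax₁ Γ ((M +[ 1𝕀 ] N) ≐ M)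
    +[]-comm  : ∀ {σ} p (M N : Tm Γ σ) → Ax₁ Γ ((M +[ p ] N) ≐ (N +[ 1- p ] M))
    +[]-assoc : ∀ {σ} p q .(p<1 : Reals._<_ 𝓡 (val p) (Reals.1# 𝓡))
                          .(q<1 : Reals._<_ 𝓡 (val q) (Reals.1# 𝓡)) (M N P : Tm Γ σ) →
                Ax₁ Γ (((M +[ p ] N) +[ q ] P) ≐
                       (M +[ p *𝕀 q ] (N +[ reweigh p q p<1 q<1 ] P)))
    +[]-idem  : ∀ {σ} p (M : Tm Γ σ) → Ax₁ Γ ((M +[ p ] M) ≐ M)
    ·-+[]     : ∀ {σ} p x (M N : Tm Γ σ) →
                Ax₁ Γ ((var x · (M +[ p ] N)) ≐ ((var x · M) +[ p ] (var x · N)))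
    ·-or      : ∀ {σ} x (M N : Tm Γ σ) →
                Ax₁ Γ ((var x · (M or N)) ≐ ((var x · M) or (var x · N)))
    +[]-or    : ∀ {σ} p (L M N : Tm Γ σ) →
                Ax₁ Γ ((L +[ p ] (M or N)) ≐ ((L +[ p ] M) or (L +[ p ] N)))
    ite-or    : ∀ {σ m} (p : Weights m) (Ls : Vec (Tm Γ σ) (suc m)) (Xs Ys : Vec (Inner Γ) (suc m)) →
                let M = prForm p Ls Xs ; N = prForm p Ls Ys in
                Ax₁ Γ (ite (Eₛ p Xs ≥ᵗ Eₛ p Ys) M N ≐ (M or N))
    ite-or-or : ∀ {σ m} (p : Weights m) (Ls : Vec (Tm Γ σ) (suc m)) (Xs Ys : Vec (Inner Γ) (suc m))
                (P : Tm Γ σ) →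
                let M = prForm p Ls Xs ; N = prForm p Ls Ys in
                Ax₁ Γ (ite (Eₛ p Xs ≥ᵗ Eₛ p Ys) (M or P) (P or N) ≐ ((M or P) or N))

  data PREffectValue {b : BaseType} : Program (base b) → Set where
    con    : (c : Con b) → PREffectValue (con c)
    _·_    : (d : Con rew) {E : Program (base b)} → PREffectValue E → PREffectValue (con d · E)
    _+[_]_ : {E₁ E₂ : Program (base b)} → PREffectValue E₁ → (p : 𝕀) → PREffectValue E₂ →
             PREffectValue (E₁ +[ p ] E₂)

Denotation : {B : Set} → Set → (B → Set) → Base B → Set
Denotation R O bool      = Bool
Denotation R O rew       = R
Denotation R O (other o) = O o

record Interpretation (𝓡 : Reals) (Sig : Signature 𝓡) (Rw : Rewards 𝓡) : Set₁ where
  open UnitInterval 𝓡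
  open Signature Sig
  open Rewards Rw
  field
    ⟦_⟧ᵒ : OtherBase → Set

  ⟦_⟧ᵇ : BaseType → Set
  ⟦_⟧ᵇ = Denotation R ⟦_⟧ᵒ

  field
    inhabited     : ∀ b → ⟦ b ⟧ᵇ
    ⟦_⟧ᶜ          : ∀ {b} → Con b → ⟦ b ⟧ᵇ
    ⟦tt⟧          : ⟦ ttᶜ ⟧ᶜ ≡ true
    ⟦ff⟧          : ⟦ ffᶜ ⟧ᶜ ≡ false
    ⟦0⟧           : ⟦ 0ᶜ ⟧ᶜ ≡ 0#
    ⟦⟧ᶜ-injective : ∀ {b} {c c′ : Con b} → ⟦ c ⟧ᶜ ≡ ⟦ c′ ⟧ᶜ → c ≡ c′
    nonzero       : Σ (Con rew) λ c → ⟦ c ⟧ᶜ ≢ 0#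
    ⟦_⟧ᶠ          : ∀ {bs b} → Fun bs b → All ⟦_⟧ᵇ bs → ⟦ b ⟧ᵇ
    ⟦+⟧           : ∀ r s → ⟦ +ᶠ ⟧ᶠ (r ∷ s ∷ []) ≡ r + s
    ⟦⊕⟧           : ∀ p r s → ⟦ ⊕ᶠ p ⟧ᶠ (r ∷ s ∷ []) ≡ r +[ p ] s
    ⟦≤⟧           : ∀ r s → ⟦ ≤ᶠ ⟧ᶠ (r ∷ s ∷ []) ≡ does (r ≤? s)
    ⟦val⟧         : ∀ {bs b} (f : Fun bs b) (cs : All Con bs) →
                    ⟦ f ⟧ᶠ (All.map ⟦_⟧ᶜ cs) ≡ ⟦ valᶠ f cs ⟧ᶜ

record IsBarycentricModule (𝓡 : Reals) (Rw : Rewards 𝓡) {A : Set}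
         (_·_ : Rewards.R Rw → A → A)
         (_+[_]_ : A → UnitInterval.𝕀 𝓡 → A → A) : Set where
  open Rewards Rw using (0#; _+_)
  field
    isBarycentric : IsBarycentric 𝓡 _+[_]_
    ·-zero        : ∀ x → 0# · x ≡ x
    ·-·           : ∀ r s x → r · (s · x) ≡ (r + s) · x
    ·-+[]         : ∀ r p x y → r · (x +[ p ] y) ≡ (r · x) +[ p ] (r · y)

record AuxiliaryMonad (𝓡 : Reals) (Rw : Rewards 𝓡) : Set₁ where
  open UnitInterval 𝓡
  open Rewards Rw using (R; _+_) renaming (_+[_]_ to _+ᴿ[_]_)
  infix  10 _†
  infixr 6 _·_
  infixl 5 _+[_]_
  field
    T       : Set → Set
    η       : ∀ {X} → X → T X
    _†      : ∀ {X Y} → (X → T Y) → T X → T Y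
    †-idˡ   : ∀ {X Y} (f : X → T Y) x → (f †) (η x) ≡ f x
    †-idʳ   : ∀ {X} (u : T X) → (η †) u ≡ u
    †-assoc : ∀ {X Y Z} (f : X → T Y) (g : Y → T Z) u →
              (g †) ((f †) u) ≡ (((g †) ∘ f) †) u
    _·_     : ∀ {X} → R → T X → T X
    _+[_]_  : ∀ {X} → T X → 𝕀 → T X → T X
    ·-alg   : ∀ {X Y} (f : X → T Y) r u → (f †) (r · u) ≡ r · (f †) u
    +[]-alg : ∀ {X Y} (f : X → T Y) p u v →
              (f †) (u +[ p ] v) ≡ (f †) u +[ p ] (f †) v

  fmap : ∀ {X Y} → (X → Y) → T X → T Y
  fmap f = (η ∘ f) †

  field
    α        : T R → R
    α-unit   : ∀ r → α (η r) ≡ r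
    α-mult   : ∀ (U : T (T R)) → α ((id †) U) ≡ α (fmap α U)
    isModule : ∀ X → IsBarycentricModule 𝓡 Rw (_·_ {X}) (_+[_]_ {X})
    α-·      : ∀ r u → α (r · u) ≡ r + α u
    α-+[]    : ∀ p u v → α (u +[ p ] v) ≡ α u +ᴿ[ p ] α v

module Semantics (𝓡 : Reals) (Sig : Signature 𝓡) (Rw : Rewards 𝓡)
                 (I : Interpretation 𝓡 Sig Rw) (𝓣 : AuxiliaryMonad 𝓡 Rw) where
  open Language 𝓡 Sig
  open Rewards Rw using (R; _≤?_)
  open Interpretation I
  open AuxiliaryMonad 𝓣 using (T; α; fmap)
    renaming (η to ηᵀ; _† to _†ᵀ; _·_ to _·ᵀ_; _+[_]_ to _+ᵀ[_]_)

  S : Set → Set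
  S X = (X → R) → T X

  𝐑⟨_∣_⟩ : ∀ {X} → S X → (X → R) → R
  𝐑⟨ F ∣ γ ⟩ = α (fmap γ (F γ))

  η : ∀ {X} → X → S X
  η x γ = ηᵀ x

  infix 10 _†
  _† : ∀ {X Y} → (X → S Y) → S X → S Y
  (f †) F γ = ((λ x → f x γ) †ᵀ) (F (λ x → 𝐑⟨ f x ∣ γ ⟩))

  _orˢ_ : ∀ {X} → S X → S X → S X
  (G₀ orˢ G₁) γ = if does (𝐑⟨ G₁ ∣ γ ⟩ ≤? 𝐑⟨ G₀ ∣ γ ⟩) then G₀ γ else G₁ γ

  _·ˢ_ : ∀ {X} → R → S X → S X
  (r ·ˢ G) γ = r ·ᵀ G γ

  _+ˢ[_]_ : ∀ {X} → S X → 𝕀 → S X → S X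
  (F +ˢ[ p ] G) γ = F γ +ᵀ[ p ] G γ

  ⟦_⟧ᵗ : Type → Set
  ⟦ base b ⟧ᵗ = ⟦ b ⟧ᵇ
  ⟦ unit   ⟧ᵗ = ⊤
  ⟦ σ ⊗ τ  ⟧ᵗ = ⟦ σ ⟧ᵗ × ⟦ τ ⟧ᵗ
  ⟦ σ ⇒ τ  ⟧ᵗ = ⟦ σ ⟧ᵗ → S ⟦ τ ⟧ᵗ

  Env : Ctx → Set
  Env = All ⟦_⟧ᵗ

  mutual
    ⟦_⟧ : ∀ {Γ σ} → Tm Γ σ → Env Γ → S ⟦ σ ⟧ᵗ
    ⟦ var x      ⟧ ρ = η (lookup ρ x)
    ⟦ con c      ⟧ ρ = η ⟦ c ⟧ᶜ
    ⟦ fun f Ms   ⟧ ρ = ((λ as → η (⟦ f ⟧ᶠ as)) †) (⟦ Ms ⟧* ρ)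
    ⟦ ite L M N  ⟧ ρ = ((λ a → if a then ⟦ M ⟧ ρ else ⟦ N ⟧ ρ) †) (⟦ L ⟧ ρ)
    ⟦ M or N     ⟧ ρ = ⟦ M ⟧ ρ orˢ ⟦ N ⟧ ρ
    ⟦ N · M      ⟧ ρ = ((λ r → r ·ˢ ⟦ M ⟧ ρ) †) (⟦ N ⟧ ρ)
    ⟦ M +[ p ] N ⟧ ρ = ⟦ M ⟧ ρ +ˢ[ p ] ⟦ N ⟧ ρ
    ⟦ ⋆          ⟧ ρ = η tt
    ⟦ pair M N   ⟧ ρ = ((λ a → ((λ b → η (a , b)) †) (⟦ N ⟧ ρ)) †) (⟦ M ⟧ ρ)
    ⟦ fst M      ⟧ ρ = ((λ a → η (proj₁ a)) †) (⟦ M ⟧ ρ)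
    ⟦ snd M      ⟧ ρ = ((λ a → η (proj₂ a)) †) (⟦ M ⟧ ρ)
    ⟦ lam M      ⟧ ρ = η (λ a → ⟦ M ⟧ (a ∷ ρ))
    ⟦ app M N    ⟧ ρ = ((λ f → (f †) (⟦ N ⟧ ρ)) †) (⟦ M ⟧ ρ)

    ⟦_⟧* : ∀ {Γ bs} → Args Γ bs → Env Γ → S (All ⟦_⟧ᵇ bs)
    ⟦ []     ⟧* ρ = η []
    ⟦ M ∷ Ms ⟧* ρ = ((λ a → ((λ as → η (a ∷ as)) †) (⟦ Ms ⟧* ρ)) †) (⟦ M ⟧ ρ)

  -- Denotations are compared as functions, so _≡_ is only the intended
  -- equality in the presence of function extensionality.
  infix 3 ⊨_
  ⊨_ : ∀ {Γ} → Assertion Γ → Set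
  ⊨ (M ≐ N)         = ⟦ M ⟧ ≡ ⟦ N ⟧
  ⊨ (_↓ {σ = σ} M) = ∀ ρ → Σ ⟦ σ ⟧ᵗ λ a → ⟦ M ⟧ ρ ≡ η a

  Valid : Theory → Set
  Valid Ax = ∀ {Γ} (A : Assertion Γ) → Ax Γ A → ⊨ A

  StronglyPurityCompleteForBasicPREffectValues : Theory → Set
  StronglyPurityCompleteForBasicPREffectValues Ax =
    ∀ {b} (E : Program (base b)) → PREffectValue E →
    ⊨ (E ↓) → Σ (Con b) λ c → Ax ⊢ E ≐ con c

  StronglyPurityCompleteAtBaseTypes : Theory → Set
  StronglyPurityCompleteAtBaseTypes Ax =
    ∀ {b} (M : Program (base b)) →
    ⊨ (M ↓) → Σ (Con b) λ c → Ax ⊢ M ≐ con c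

{-# OPTIONS --safe #-}
module Submission where

-- By a logical relation, every program of base type is provably equal to a
-- choice, by or, among mixtures ∑ᵢ pᵢ (dᵢ · cᵢ) with weights in (0,1), and it
-- denotes the corresponding selection.  Suppose that it denotes η(a).  Under
-- every reward function γ, no mixture then has a larger reward than γ(a).  If
-- some mixture returned a value other than a, let γ be l on a and r elsewhere:
-- its reward is at least s + (r +_p l) for some p > 0 and s ≤ 0 independent of
-- l and r, and some l ≤ r make this exceed l: by condition (C) if p < 1 and
-- s < 0, and because R has a nonzero element otherwise.  So all mixtures return
-- the same constant c.  The one with the larger mean reward then wins against
-- the other under every γ, and provably so, as both are in expectation PR-form
-- over c.  Hence the program is equal to a single mixture, which is a pure
-- PR-effect value.

open import Level using (0ℓ)
open import Algebra.Structures using (IsCommutativeMonoid)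
open import Axiom.ExcludedMiddle using (ExcludedMiddle)
open import Axiom.Extensionality.Propositional using (Extensionality)
open import Data.Bool.Base using (Bool; true; false; if_then_else_)
open import Data.Empty using (⊥-elim)
open import Data.List.Base using (List; []; _∷_)
open import Data.List.Membership.Propositional using (_∈_)
open import Data.List.Relation.Binary.Subset.Propositional using (_⊆_)
open import Data.List.Relation.Binary.Subset.Propositional.Properties using (∷⁺ʳ)
open import Data.List.Relation.Unary.All as All using (All; []; _∷_)
open import Data.List.Relation.Unary.Any using (here; there)
open import Data.Nat.Base using (ℕ; zero; suc)
open import Data.Product.Base using (Σ; ∃; ∃₂; _×_; _,_; proj₁; proj₂)
open import Data.Sum.Base using (_⊎_; inj₁; inj₂)
open import Data.Vec.Base as Vec using (Vec; []; _∷_)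
open import Data.Vec.Properties using (map-∘)
open import Function.Base using (_∘_; id)
open import Function.Bundles using (_⇔_; Equivalence)
open import Relation.Binary.Structures using (IsDecTotalOrder; IsEquivalence)
open import Relation.Binary.PropositionalEquality
  using (_≡_; _≢_; refl; sym; trans; cong; cong₂; subst; subst₂; isEquivalence; module ≡-Reasoning)
open import Relation.Nullary.Decidable using (does; yes; no; does-⇔)
open import Relation.Nullary.Negation using (¬_; contradiction)
open import Defs

private
  cong₃ : {A B C D : Set} (f : A → B → C → D) {a a′ : A} {b b′ : B} {c c′ : C} →
          a ≡ a′ → b ≡ b′ → c ≡ c′ → f a b c ≡ f a′ b′ c′
  cong₃ f refl refl refl = refl

-- Substitution calculus.

module Substitution (𝓡 : Reals) (Sig : Signature 𝓡) where
  open Language 𝓡 Sig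

  mutual
    -- Here and below, substitutions and renamings are compared variable by variable: they are
    -- functions, and a lifted one agrees with the one expected under a binder only after a case
    -- split on the variable.
    sub-id : ∀ {Γ σ} {θ : Subst Γ Γ} → (∀ {τ} (x : τ ∈ Γ) → θ x ≡ var x) →
             (M : Tm Γ σ) → sub θ M ≡ M
    sub-id h (var x)        = h x
    sub-id h (con c)        = refl
    sub-id h (fun f Ms)     = cong (fun f) (subArgs-id h Ms)
    sub-id h (ite L M N)    = cong₃ ite (sub-id h L) (sub-id h M) (sub-id h N)
    sub-id h (M or N)       = cong₂ _or_ (sub-id h M) (sub-id h N)
    sub-id h (N · M)        = cong₂ _·_ (sub-id h N) (sub-id h M)
    sub-id h (M +[ p ] N)   = cong₂ _+[ p ]_ (sub-id h M) (sub-id h N)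
    sub-id h ⋆              = refl
    sub-id h (pair M N)     = cong₂ pair (sub-id h M) (sub-id h N)
    sub-id h (fst M)        = cong fst (sub-id h M)
    sub-id h (snd M)        = cong snd (sub-id h M)
    sub-id {θ = θ} h (lam M) = cong lam (sub-id lifted M)
      where
      lifted : ∀ {τ} (x : τ ∈ _) → liftˢ θ x ≡ var x
      lifted (here refl) = refl
      lifted (there x)   = cong wk (h x)
    sub-id h (app M N)      = cong₂ app (sub-id h M) (sub-id h N)

    subArgs-id : ∀ {Γ bs} {θ : Subst Γ Γ} → (∀ {τ} (x : τ ∈ Γ) → θ x ≡ var x) →
                 (Ms : Args Γ bs) → subArgs θ Ms ≡ Ms
    subArgs-id h []       = refl
    subArgs-id h (M ∷ Ms) = cong₂ _∷_ (sub-id h M) (subArgs-id h Ms)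

  mutual
    ren-ren : ∀ {Γ Δ Θ σ} {g : Δ ⊆ Θ} {f : Γ ⊆ Δ} {h : Γ ⊆ Θ} →
              (∀ {τ} (x : τ ∈ Γ) → g (f x) ≡ h x) →
              (M : Tm Γ σ) → ren g (ren f M) ≡ ren h M
    ren-ren e (var x)        = cong var (e x)
    ren-ren e (con c)        = refl
    ren-ren e (fun f Ms)     = cong (fun f) (renArgs-renArgs e Ms)
    ren-ren e (ite L M N)    = cong₃ ite (ren-ren e L) (ren-ren e M) (ren-ren e N)
    ren-ren e (M or N)       = cong₂ _or_ (ren-ren e M) (ren-ren e N)
    ren-ren e (N · M)        = cong₂ _·_ (ren-ren e N) (ren-ren e M)
    ren-ren e (M +[ p ] N)   = cong₂ _+[ p ]_ (ren-ren e M) (ren-ren e N)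
    ren-ren e ⋆              = refl
    ren-ren e (pair M N)     = cong₂ pair (ren-ren e M) (ren-ren e N)
    ren-ren e (fst M)        = cong fst (ren-ren e M)
    ren-ren e (snd M)        = cong snd (ren-ren e M)
    ren-ren {g = g} {f} {h} e (lam {σ} M) = cong lam (ren-ren lifted M)
      where
      lifted : ∀ {τ} (x : τ ∈ _) → ∷⁺ʳ σ g (∷⁺ʳ σ f x) ≡ ∷⁺ʳ σ h x
      lifted (here refl) = refl
      lifted (there x)   = cong there (e x)
    ren-ren e (app M N)      = cong₂ app (ren-ren e M) (ren-ren e N)

    renArgs-renArgs : ∀ {Γ Δ Θ bs} {g : Δ ⊆ Θ} {f : Γ ⊆ Δ} {h : Γ ⊆ Θ} →
                      (∀ {τ} (x : τ ∈ Γ) → g (f x) ≡ h x) →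
                      (Ms : Args Γ bs) → renArgs g (renArgs f Ms) ≡ renArgs h Ms
    renArgs-renArgs e []       = refl
    renArgs-renArgs e (M ∷ Ms) = cong₂ _∷_ (ren-ren e M) (renArgs-renArgs e Ms)

  mutual
    sub-ren : ∀ {Γ Δ Θ σ} {θ : Subst Δ Θ} {f : Γ ⊆ Δ} {ξ : Subst Γ Θ} →
              (∀ {τ} (x : τ ∈ Γ) → θ (f x) ≡ ξ x) →
              (M : Tm Γ σ) → sub θ (ren f M) ≡ sub ξ M
    sub-ren e (var x)        = e x
    sub-ren e (con c)        = refl
    sub-ren e (fun f Ms)     = cong (fun f) (subArgs-renArgs e Ms)
    sub-ren e (ite L M N)    = cong₃ ite (sub-ren e L) (sub-ren e M) (sub-ren e N)
    sub-ren e (M or N)       = cong₂ _or_ (sub-ren e M) (sub-ren e N)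
    sub-ren e (N · M)        = cong₂ _·_ (sub-ren e N) (sub-ren e M)
    sub-ren e (M +[ p ] N)   = cong₂ _+[ p ]_ (sub-ren e M) (sub-ren e N)
    sub-ren e ⋆              = refl
    sub-ren e (pair M N)     = cong₂ pair (sub-ren e M) (sub-ren e N)
    sub-ren e (fst M)        = cong fst (sub-ren e M)
    sub-ren e (snd M)        = cong snd (sub-ren e M)
    sub-ren {θ = θ} {f} {ξ} e (lam {σ} M) = cong lam (sub-ren lifted M)
      where
      lifted : ∀ {τ} (x : τ ∈ _) → liftˢ θ (∷⁺ʳ σ f x) ≡ liftˢ ξ x
      lifted (here refl) = refl
      lifted (there x)   = cong wk (e x)
    sub-ren e (app M N)      = cong₂ app (sub-ren e M) (sub-ren e N)

    subArgs-renArgs : ∀ {Γ Δ Θ bs} {θ : Subst Δ Θ} {f : Γ ⊆ Δ} {ξ : Subst Γ Θ} →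
                      (∀ {τ} (x : τ ∈ Γ) → θ (f x) ≡ ξ x) →
                      (Ms : Args Γ bs) → subArgs θ (renArgs f Ms) ≡ subArgs ξ Ms
    subArgs-renArgs e []       = refl
    subArgs-renArgs e (M ∷ Ms) = cong₂ _∷_ (sub-ren e M) (subArgs-renArgs e Ms)

  mutual
    ren-sub : ∀ {Γ Δ Θ σ} {f : Δ ⊆ Θ} {θ : Subst Γ Δ} {ξ : Subst Γ Θ} →
              (∀ {τ} (x : τ ∈ Γ) → ren f (θ x) ≡ ξ x) →
              (M : Tm Γ σ) → ren f (sub θ M) ≡ sub ξ M
    ren-sub e (var x)        = e x
    ren-sub e (con c)        = refl
    ren-sub e (fun f Ms)     = cong (fun f) (renArgs-subArgs e Ms)
    ren-sub e (ite L M N)    = cong₃ ite (ren-sub e L) (ren-sub e M) (ren-sub e N)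
    ren-sub e (M or N)       = cong₂ _or_ (ren-sub e M) (ren-sub e N)
    ren-sub e (N · M)        = cong₂ _·_ (ren-sub e N) (ren-sub e M)
    ren-sub e (M +[ p ] N)   = cong₂ _+[ p ]_ (ren-sub e M) (ren-sub e N)
    ren-sub e ⋆              = refl
    ren-sub e (pair M N)     = cong₂ pair (ren-sub e M) (ren-sub e N)
    ren-sub e (fst M)        = cong fst (ren-sub e M)
    ren-sub e (snd M)        = cong snd (ren-sub e M)
    ren-sub {f = f} {θ} {ξ} e (lam {σ} M) = cong lam (ren-sub lifted M)
      where
      lifted : ∀ {τ} (x : τ ∈ _) → ren (∷⁺ʳ σ f) (liftˢ θ x) ≡ liftˢ ξ x
      lifted (here refl) = refl
      lifted (there x)   =
        -- Weakening commutes with renaming, as both orders give the renaming along one composite.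
        trans (ren-ren (λ _ → refl) (θ x)) (trans (sym (ren-ren (λ _ → refl) (θ x))) (cong wk (e x)))
    ren-sub e (app M N)      = cong₂ app (ren-sub e M) (ren-sub e N)

    renArgs-subArgs : ∀ {Γ Δ Θ bs} {f : Δ ⊆ Θ} {θ : Subst Γ Δ} {ξ : Subst Γ Θ} →
                      (∀ {τ} (x : τ ∈ Γ) → ren f (θ x) ≡ ξ x) →
                      (Ms : Args Γ bs) → renArgs f (subArgs θ Ms) ≡ subArgs ξ Ms
    renArgs-subArgs e []       = refl
    renArgs-subArgs e (M ∷ Ms) = cong₂ _∷_ (ren-sub e M) (renArgs-subArgs e Ms)

  liftˢ-wk : ∀ {Γ Δ σ τ} (θ : Subst Γ Δ) (M : Tm Γ σ) →
             sub (liftˢ {τ = τ} θ) (wk M) ≡ wk (sub θ M)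
  liftˢ-wk θ M = trans (sub-ren (λ _ → refl) M) (sym (ren-sub (λ _ → refl) M))

  liftˢ-wkArgs : ∀ {Γ Δ bs τ} (θ : Subst Γ Δ) (Ms : Args Γ bs) →
                 subArgs (liftˢ {τ = τ} θ) (renArgs there Ms) ≡ renArgs there (subArgs θ Ms)
  liftˢ-wkArgs θ Ms =
    trans (subArgs-renArgs (λ _ → refl) Ms) (sym (renArgs-subArgs (λ _ → refl) Ms))

  mutual
    sub-sub : ∀ {Γ Δ Θ σ} {θ : Subst Δ Θ} {ξ : Subst Γ Δ} {ζ : Subst Γ Θ} →
              (∀ {τ} (x : τ ∈ Γ) → sub θ (ξ x) ≡ ζ x) →
              (M : Tm Γ σ) → sub θ (sub ξ M) ≡ sub ζ M
    sub-sub e (var x)        = e x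
    sub-sub e (con c)        = refl
    sub-sub e (fun f Ms)     = cong (fun f) (subArgs-subArgs e Ms)
    sub-sub e (ite L M N)    = cong₃ ite (sub-sub e L) (sub-sub e M) (sub-sub e N)
    sub-sub e (M or N)       = cong₂ _or_ (sub-sub e M) (sub-sub e N)
    sub-sub e (N · M)        = cong₂ _·_ (sub-sub e N) (sub-sub e M)
    sub-sub e (M +[ p ] N)   = cong₂ _+[ p ]_ (sub-sub e M) (sub-sub e N)
    sub-sub e ⋆              = refl
    sub-sub e (pair M N)     = cong₂ pair (sub-sub e M) (sub-sub e N)
    sub-sub e (fst M)        = cong fst (sub-sub e M)
    sub-sub e (snd M)        = cong snd (sub-sub e M)
    sub-sub {θ = θ} {ξ} {ζ} e (lam {σ} M) = cong lam (sub-sub lifted M)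
      where
      lifted : ∀ {τ} (x : τ ∈ _) → sub (liftˢ θ) (liftˢ ξ x) ≡ liftˢ ζ x
      lifted (here refl) = refl
      lifted (there x)   = trans (liftˢ-wk θ (ξ x)) (cong wk (e x))
    sub-sub e (app M N)      = cong₂ app (sub-sub e M) (sub-sub e N)

    subArgs-subArgs : ∀ {Γ Δ Θ bs} {θ : Subst Δ Θ} {ξ : Subst Γ Δ} {ζ : Subst Γ Θ} →
                      (∀ {τ} (x : τ ∈ Γ) → sub θ (ξ x) ≡ ζ x) →
                      (Ms : Args Γ bs) → subArgs θ (subArgs ξ Ms) ≡ subArgs ζ Ms
    subArgs-subArgs e []       = refl
    subArgs-subArgs e (M ∷ Ms) = cong₂ _∷_ (sub-sub e M) (subArgs-subArgs e Ms)

  wk-single : ∀ {Γ σ τ} {N : Tm Γ τ} (M : Tm Γ σ) → wk M [ N ] ≡ M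
  wk-single M = trans (sub-ren (λ _ → refl) M) (sub-id (λ _ → refl) M)

  wkArgs-single : ∀ {Γ bs τ} {N : Tm Γ τ} (Ms : Args Γ bs) →
                  subArgs (single N) (renArgs there Ms) ≡ Ms
  wkArgs-single Ms = trans (subArgs-renArgs (λ _ → refl) Ms) (subArgs-id (λ _ → refl) Ms)

  infixl 5 _,ˢ_
  _,ˢ_ : ∀ {Γ Δ τ} → Subst Γ Δ → Tm Δ τ → Subst (τ ∷ Γ) Δ
  (θ ,ˢ M) (here refl) = M
  (θ ,ˢ M) (there x)   = θ x

  -- Needed for abstractions in `computable`: β-reducing a closed instance of `lam M` yields an
  -- instance of `M` under the extended substitution.
  liftˢ-single : ∀ {Γ Δ σ τ} (θ : Subst Γ Δ) (N : Tm Δ τ) (M : Tm (τ ∷ Γ) σ) →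
                 sub (liftˢ θ) M [ N ] ≡ sub (θ ,ˢ N) M
  liftˢ-single θ N = sub-sub pointwise
    where
    pointwise : ∀ {υ} (x : υ ∈ _) → sub (single N) (liftˢ θ x) ≡ (θ ,ˢ N) x
    pointwise (here refl) = refl
    pointwise (there x)   = wk-single (θ x)

  liftsˢ : ∀ {Γ Δ} bs → Subst Γ Δ → Subst (Γ ▷ bs) (Δ ▷ bs)
  liftsˢ []       θ = θ
  liftsˢ (b ∷ bs) θ = liftsˢ bs (liftˢ θ)

  sub-lets : ∀ {Γ Δ bs σ} (θ : Subst Γ Δ) (Ms : Args Γ bs) (N : Tm (Γ ▷ bs) σ) →
             sub θ (lets Ms N) ≡ lets (subArgs θ Ms) (sub (liftsˢ bs θ) N)
  sub-lets θ []       N = refl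
  sub-lets {bs = _ ∷ bs} θ (M ∷ Ms) N = cong (lett (sub θ M))
    (trans (sub-lets (liftˢ θ) (renArgs there Ms) N)
           (cong (λ Ls → lets Ls (sub (liftsˢ bs (liftˢ θ)) N)) (liftˢ-wkArgs θ Ms)))

  wks : ∀ {Γ σ} bs → Tm Γ σ → Tm (Γ ▷ bs) σ
  wks []       M = M
  wks (b ∷ bs) M = wks bs (wk M)

  wks-con : ∀ {Γ b} bs (c : Con b) → wks {Γ} bs (con c) ≡ con c
  wks-con []       c = refl
  wks-con (b ∷ bs) c = wks-con bs c

  liftsˢ-thereAll : ∀ {Γ Δ σ} bs (θ : Subst Γ Δ) (x : σ ∈ Γ) →
                    liftsˢ bs θ (thereAll bs x) ≡ wks bs (θ x)
  liftsˢ-thereAll []       θ x = refl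
  liftsˢ-thereAll (b ∷ bs) θ x = liftsˢ-thereAll bs (liftˢ θ) (there x)

  liftsˢ-letVars : ∀ {Γ Δ} bs (θ : Subst Γ Δ) → subArgs (liftsˢ bs θ) (letVars bs) ≡ letVars bs
  liftsˢ-letVars []       θ = refl
  liftsˢ-letVars (b ∷ bs) θ = cong₂ _∷_
    (trans (liftsˢ-thereAll bs (liftˢ θ) (here refl)) (wks-v₀ bs))
    (liftsˢ-letVars bs (liftˢ θ))
    where
    wks-var : ∀ {Γ σ} bs (x : σ ∈ Γ) → wks bs (var x) ≡ var (thereAll bs x)
    wks-var []       x = refl
    wks-var (b ∷ bs) x = wks-var bs (there x)
    wks-v₀ : ∀ {Γ σ} bs → wks bs (v₀ {Γ} {σ}) ≡ var (thereAll bs (here refl))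
    wks-v₀ bs = wks-var bs (here refl)

  -- Follows the order of β-reduction in `lets`: the constant of the outermost let goes first,
  -- underneath the binders of the remaining ones.
  instantiate : ∀ {bs σ} → All Con bs → Tm ([] ▷ bs) σ → Program σ
  instantiate []             N = N
  instantiate {_ ∷ bs} (c ∷ cs) N = instantiate cs (sub (liftsˢ bs (single (con c))) N)

  instantiateArgs : ∀ {bs bs′} → All Con bs → Args ([] ▷ bs) bs′ → Args [] bs′
  instantiateArgs []             Ns = Ns
  instantiateArgs {_ ∷ bs} (c ∷ cs) Ns =
    instantiateArgs cs (subArgs (liftsˢ bs (single (con c))) Ns)

  instantiate-fun : ∀ {bs bs′ b} (f : Fun bs′ b) (cs : All Con bs) (Ns : Args ([] ▷ bs) bs′) →
                    instantiate cs (fun f Ns) ≡ fun f (instantiateArgs cs Ns)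
  instantiate-fun f []       Ns = refl
  instantiate-fun f (c ∷ cs) Ns = instantiate-fun f cs _

  instantiate-con : ∀ {bs b} (cs : All Con bs) (c : Con b) → instantiate cs (con c) ≡ con c
  instantiate-con []       c = refl
  instantiate-con (_ ∷ cs) c = instantiate-con cs c

  instantiateArgs-∷ : ∀ {bs b bs′} (cs : All Con bs) (N : Tm ([] ▷ bs) (base b))
                      (Ns : Args ([] ▷ bs) bs′) →
                      instantiateArgs cs (N ∷ Ns) ≡ instantiate cs N ∷ instantiateArgs cs Ns
  instantiateArgs-∷ []       N Ns = refl
  instantiateArgs-∷ (c ∷ cs) N Ns = instantiateArgs-∷ cs _ _

  -- Brings the body that `eval-fun` produces into the shape to which `fun-val` applies.
  instantiate-letVars : ∀ {bs} (cs : All Con bs) → instantiateArgs cs (letVars bs) ≡ All.map con cs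
  instantiate-letVars [] = refl
  instantiate-letVars {_ ∷ bs} (c ∷ cs) = trans (instantiateArgs-∷ cs _ _) (cong₂ _∷_
    (trans (cong (instantiate cs)
             (trans (liftsˢ-thereAll bs (single (con c)) (here refl)) (wks-con bs c)))
           (instantiate-con cs c))
    (trans (cong (instantiateArgs cs) (liftsˢ-letVars bs (single (con c))))
           (instantiate-letVars cs)))

-- Derived rules of the equational logic.

module Derivability (𝓡 : Reals) (Sig : Signature 𝓡) (Ax : Language.Theory 𝓡 Sig) where
  open Language 𝓡 Sig
  open Substitution 𝓡 Sig

  ≡⇒≐ : ∀ {Γ σ} {M N : Tm Γ σ} → M ≡ N → Ax ⊢ M ≐ N
  ≡⇒≐ refl = ≐-refl

  -- The rule `β-var` speaks of variables only. It is applied to a weakened abstraction and a fresh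
  -- variable, for which the pure term `V` is then substituted.
  β : ∀ {Γ σ τ} (M : Tm (σ ∷ Γ) τ) {V : Tm Γ σ} → Ax ⊢ V ↓ → Ax ⊢ lett V M ≐ M [ V ]
  β {Γ} {σ} M {V} V↓ = subst₂ (λ M₁ M₂ → Ax ⊢ lett V M₁ ≐ M₂ [ V ])
    (trans (sub-ren (λ _ → refl) M) (sub-id under-binder M))
    (trans (sub-ren (λ _ → refl) M) (sub-id at-variable M))
    (substitution V↓ (β-var (ren (∷⁺ʳ σ there) M) (here refl)))
    where
    under-binder : ∀ {υ} (x : υ ∈ σ ∷ Γ) → liftˢ (single V) (∷⁺ʳ σ there x) ≡ var x
    under-binder (here refl) = refl
    under-binder (there x)   = refl
    at-variable : ∀ {υ} (x : υ ∈ σ ∷ Γ) → single v₀ (∷⁺ʳ σ there x) ≡ var x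
    at-variable (here refl) = refl
    at-variable (there x)   = refl

  -- An abstraction is pure, so `lam K` may replace the function variable in `alg-or`; the same
  -- argument gives the next two laws.
  lett-or : ∀ {Γ σ τ} (M N : Tm Γ σ) (K : Tm (σ ∷ Γ) τ) →
            Ax ⊢ lett (M or N) K ≐ (lett M K or lett N K)
  lett-or M N K = subst₂ (λ M₁ N₁ → Ax ⊢ lett (M₁ or N₁) K ≐ (lett M₁ K or lett N₁ K))
    (wk-single M) (wk-single N)
    (substitution (lam-↓ K) (alg-or (here refl) (wk M) (wk N)))

  lett-+[] : ∀ {Γ σ τ} p (M N : Tm Γ σ) (K : Tm (σ ∷ Γ) τ) →
             Ax ⊢ lett (M +[ p ] N) K ≐ (lett M K +[ p ] lett N K)
  lett-+[] p M N K = subst₂ (λ M₁ N₁ → Ax ⊢ lett (M₁ +[ p ] N₁) K ≐ (lett M₁ K +[ p ] lett N₁ K))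
    (wk-single M) (wk-single N)
    (substitution (lam-↓ K) (alg-+[] (here refl) p (wk M) (wk N)))

  lett-· : ∀ {Γ σ τ} d (M : Tm Γ σ) (K : Tm (σ ∷ Γ) τ) →
           Ax ⊢ lett (con d · M) K ≐ (con d · lett M K)
  lett-· d M K = subst (λ M₁ → Ax ⊢ lett (con d · M₁) K ≐ (con d · lett M₁ K))
    (trans (cong (_[ lam K ]) (wk-single {N = con d} (wk M))) (wk-single M))
    (substitution (lam-↓ K) (substitution (con-↓ d)
      (alg-· (there (here refl)) (here refl) (wk (wk M)))))

  pair-pure : ∀ {Γ σ τ} {V : Tm Γ σ} {W : Tm Γ τ} → Ax ⊢ V ↓ → Ax ⊢ W ↓ → Ax ⊢ pair V W ↓
  pair-pure {V = V} {W} V↓ W↓ = subst (λ V₁ → Ax ⊢ pair V₁ W ↓) (wk-single V)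
    (substitution W↓ (substitution (weakening there V↓) (pair-↓ (here refl) (there (here refl)))))

  fst-pair : ∀ {Γ σ τ} {V : Tm Γ σ} {W : Tm Γ τ} → Ax ⊢ V ↓ → Ax ⊢ W ↓ → Ax ⊢ fst (pair V W) ≐ V
  fst-pair {V = V} {W} V↓ W↓ = subst (λ V₁ → Ax ⊢ fst (pair V₁ W) ≐ V₁) (wk-single V)
    (substitution W↓ (substitution (weakening there V↓) (β-fst (here refl) (there (here refl)))))

  snd-pair : ∀ {Γ σ τ} {V : Tm Γ σ} {W : Tm Γ τ} → Ax ⊢ V ↓ → Ax ⊢ W ↓ → Ax ⊢ snd (pair V W) ≐ W
  snd-pair {V = V} {W} V↓ W↓ = subst (λ V₁ → Ax ⊢ snd (pair V₁ W) ≐ W) (wk-single V)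
    (substitution W↓ (substitution (weakening there V↓) (β-snd (here refl) (there (here refl)))))

  ite-wk : ∀ {Γ σ} (M N : Tm Γ σ) {V : Tm Γ (base bool)} → Ax ⊢ V ↓ →
           Ax ⊢ lett V (ite v₀ (wk M) (wk N)) ≐ ite V M N
  ite-wk M N {V} V↓ = ≐-trans (β _ V↓) (≡⇒≐ (cong₂ (ite V) (wk-single M) (wk-single N)))

-- Kleisli extension and operations of the monad `S`.

module SelectionMonad (ext : Extensionality 0ℓ 0ℓ)
    (𝓡 : Reals) (Sig : Signature 𝓡) (Rw : Rewards 𝓡)
    (I : Interpretation 𝓡 Sig Rw) (𝓣 : AuxiliaryMonad 𝓡 Rw) where
  open Semantics 𝓡 Sig Rw I 𝓣
  open Rewards Rw using (R; _≤?_; _+_) renaming (_+[_]_ to _+ᴿ[_]_)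
  open AuxiliaryMonad 𝓣 using (T; α; fmap; †-idˡ; †-assoc; α-mult; α-unit; ·-alg; +[]-alg; α-·; α-+[])
    renaming (η to ηᵀ; _† to _†ᵀ; _·_ to _·ᵀ_; _+[_]_ to _+ᵀ[_]_)

  -- This is the multiplication law of the algebra `α`, taken at `fmap g u`.
  α∘fmap : ∀ {X} (g : X → T R) u → α (fmap (α ∘ g) u) ≡ α ((g †ᵀ) u)
  α∘fmap g u = begin
    α (fmap (α ∘ g) u)               ≡⟨ cong (λ k → α ((k †ᵀ) u)) (ext λ x → sym (†-idˡ (ηᵀ ∘ α) (g x))) ⟩
    α (((fmap α ∘ (ηᵀ ∘ g)) †ᵀ) u)   ≡⟨ cong α (†-assoc (ηᵀ ∘ g) (ηᵀ ∘ α) u) ⟨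
    α (fmap α (fmap g u))            ≡⟨ α-mult (fmap g u) ⟨
    α ((id †ᵀ) (fmap g u))           ≡⟨ cong α (†-assoc (ηᵀ ∘ g) id u) ⟩
    α ((((id †ᵀ) ∘ (ηᵀ ∘ g)) †ᵀ) u)  ≡⟨ cong (λ k → α ((k †ᵀ) u)) (ext λ x → †-idˡ id (g x)) ⟩
    α ((g †ᵀ) u)                     ∎
    where open ≡-Reasoning

  reward : ∀ {X} → (X → R) → T X → R
  reward γ u = α (fmap γ u)

  reward-η : ∀ {X} (γ : X → R) x → reward γ (ηᵀ x) ≡ γ x
  reward-η γ x = trans (cong α (†-idˡ (ηᵀ ∘ γ) x)) (α-unit (γ x))

  reward-· : ∀ {X} (γ : X → R) r u → reward γ (r ·ᵀ u) ≡ r + reward γ u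
  reward-· γ r u = trans (cong α (·-alg (ηᵀ ∘ γ) r u)) (α-· r _)

  reward-+[] : ∀ {X} (γ : X → R) p u v → reward γ (u +ᵀ[ p ] v) ≡ reward γ u +ᴿ[ p ] reward γ v
  reward-+[] γ p u v = trans (cong α (+[]-alg (ηᵀ ∘ γ) p u v)) (α-+[] p _ _)

  -- Backward induction: `F` is judged by the rewards that its continuation `f` will earn under `γ`.
  𝐑-† : ∀ {X Y} (f : X → S Y) (F : S X) γ → 𝐑⟨ (f †) F ∣ γ ⟩ ≡ 𝐑⟨ F ∣ (λ x → 𝐑⟨ f x ∣ γ ⟩) ⟩
  𝐑-† f F γ = trans (cong α (†-assoc _ _ _)) (sym (α∘fmap (λ x → fmap γ (f x γ)) _))

  †-η : ∀ {X Y} (f : X → S Y) x → (f †) (η x) ≡ f x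
  †-η f x = ext λ γ → †-idˡ _ x

  -- At each `γ` this is associativity in `T`, once `𝐑-†` has identified the two reward functions
  -- that are passed to `F`.
  †-assocˢ : ∀ {X Y Z} (f : X → S Y) (g : Y → S Z) F → (g †) ((f †) F) ≡ (((g †) ∘ f) †) F
  †-assocˢ f g F = ext λ γ → trans (†-assoc _ _ _)
    (cong (λ γ′ → ((λ x → ((g †) (f x)) γ) †ᵀ) (F γ′)) (ext λ x → sym (𝐑-† g (f x) γ)))

  -- By `𝐑-†` both sides compare the same two rewards, hence they select the same alternative.
  †-or : ∀ {X Y} (f : X → S Y) F G → (f †) (F orˢ G) ≡ ((f †) F orˢ (f †) G)
  †-or {X} {Y} f F G = ext pointwise
    where
    pointwise : ∀ γ → (f †) (F orˢ G) γ ≡ ((f †) F orˢ (f †) G) γ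
    pointwise γ rewrite 𝐑-† f F γ | 𝐑-† f G γ
      with does (𝐑⟨ G ∣ (λ x → 𝐑⟨ f x ∣ γ ⟩) ⟩ ≤? 𝐑⟨ F ∣ (λ x → 𝐑⟨ f x ∣ γ ⟩) ⟩)
    ... | true  = refl
    ... | false = refl

  †-· : ∀ {X Y} (f : X → S Y) r F → (f †) (r ·ˢ F) ≡ r ·ˢ (f †) F
  †-· f r F = ext λ γ → ·-alg _ r _

  †-+[] : ∀ {X Y} (f : X → S Y) p F G → (f †) (F +ˢ[ p ] G) ≡ ((f †) F +ˢ[ p ] (f †) G)
  †-+[] f p F G = ext λ γ → +[]-alg _ p _ _

-- The logical relation and its fundamental lemma.

-- A logical relation between programs and denotations: a program is related
-- to a tree of effects over values both provably and semantically, so the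
-- passage to a normal form needs no soundness theorem for the logic.
module Computability (ext : Extensionality 0ℓ 0ℓ)
    (𝓡 : Reals) (Sig : Signature 𝓡) (Rw : Rewards 𝓡)
    (I : Interpretation 𝓡 Sig Rw) (𝓣 : AuxiliaryMonad 𝓡 Rw) (Ax : Language.Theory 𝓡 Sig) where
  open Language 𝓡 Sig
  open Substitution 𝓡 Sig
  open Derivability 𝓡 Sig Ax
  open Semantics 𝓡 Sig Rw I 𝓣
  open SelectionMonad ext 𝓡 Sig Rw I 𝓣
  open Interpretation I

  data Computable {σ} (P : Program σ → ⟦ σ ⟧ᵗ → Set) : Program σ → S ⟦ σ ⟧ᵗ → Set where
    ret    : ∀ {V a} → P V a → Computable P V (η a)
    _or_   : ∀ {M N F G} → Computable P M F → Computable P N G → Computable P (M or N) (F orˢ G)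
    act    : ∀ d {M F} → Computable P M F → Computable P (con d · M) (⟦ d ⟧ᶜ ·ˢ F)
    _+[_]_ : ∀ {M N F G} → Computable P M F → ∀ p → Computable P N G →
             Computable P (M +[ p ] N) (F +ˢ[ p ] G)
    conv   : ∀ {M N F G} → Ax ⊢ M ≐ N → F ≡ G → Computable P N G → Computable P M F

  -- Induction on the tree. Every effect commutes with `lett` provably and with Kleisli extension
  -- semantically, so the continuation has to deal with values only.
  bind : ∀ {σ τ} {P : Program σ → ⟦ σ ⟧ᵗ → Set} {Q : Program τ → ⟦ τ ⟧ᵗ → Set}
         {M F} {K : Tm (σ ∷ []) τ} {f} → Computable P M F →
         (∀ V a → P V a → Computable Q (lett V K) (f a)) → Computable Q (lett M K) ((f †) F)
  bind {f = f} (ret {V} {a} p) k = conv ≐-refl (†-η f a) (k V a p)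
  bind {f = f} (_or_ {F = F} {G} c d) k =
    conv (lett-or _ _ _) (†-or f F G) (bind {F = F} c k or bind {F = G} d k)
  bind {f = f} (act d {F = F} c) k = conv (lett-· d _ _) (†-· f ⟦ d ⟧ᶜ F) (act d (bind {F = F} c k))
  bind {f = f} (_+[_]_ {F = F} {G} c p d) k =
    conv (lett-+[] p _ _ _) (†-+[] f p F G) (bind {F = F} c k +[ p ] bind {F = G} d k)
  bind {f = f} (conv {G = G} M≐N F≡G c) k =
    conv (cong-app ≐-refl M≐N) (cong (f †) F≡G) (bind {F = G} c k)

  -- Purity is demanded at function types only; at the other types `pure` derives it from the
  -- provable form of the value.
  Val : ∀ σ → Program σ → ⟦ σ ⟧ᵗ → Set
  Val (base b) V a       = Σ (Con b) λ c → (Ax ⊢ V ≐ con c) × a ≡ ⟦ c ⟧ᶜ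
  Val unit     V a       = Ax ⊢ V ≐ ⋆
  Val (σ ⊗ τ)  V (a , b) = ∃₂ λ V₁ V₂ → (Ax ⊢ V ≐ pair V₁ V₂) × Val σ V₁ a × Val τ V₂ b
  Val (σ ⇒ τ)  V f       =
    (Ax ⊢ V ↓) × (∀ W a → Val σ W a → Computable (Val τ) (app V W) (f a))

  pure : ∀ σ {V a} → Val σ V a → Ax ⊢ V ↓
  pure (base b) (c , V≐c , _)            = ↓-resp-≐ (≐-sym V≐c) (con-↓ c)
  pure unit     V≐⋆                      = ↓-resp-≐ (≐-sym V≐⋆) ⋆-↓
  pure (σ ⊗ τ)  (_ , _ , V≐ , v₁ , v₂)   = ↓-resp-≐ (≐-sym V≐) (pair-pure (pure σ v₁) (pure τ v₂))
  pure (σ ⇒ τ)  (V↓ , _)                 = V↓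

  Vals : ∀ {Γ} → Subst Γ [] → Env Γ → Set
  Vals {Γ} θ ρ = ∀ {σ} (x : σ ∈ Γ) → Val σ (θ x) (All.lookup ρ x)

  extend : ∀ {Γ σ} {θ : Subst Γ []} {ρ W a} → Vals θ ρ → Val σ W a → Vals (θ ,ˢ W) (a ∷ ρ)
  extend vs w (here refl) = w
  extend vs w (there x)   = vs x

  mutual
    -- The fundamental lemma, by induction on terms: the evaluation-order equations turn each
    -- construct into lets, `bind` carries the effects past them, and `β` inserts the values.
    computable : ∀ {Γ σ} (M : Tm Γ σ) {θ : Subst Γ []} {ρ} → Vals θ ρ →
                 Computable (Val σ) (sub θ M) (⟦ M ⟧ ρ)
    computable (var x) vs = ret (vs x)
    computable (con c) vs = ret (c , ≐-refl , refl)
    computable (fun {bs} f Ms) {θ} vs =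
      conv (eval-fun f (subArgs θ Ms)) refl (computable-lets Ms vs λ cs →
        subst₂ (Computable _) (sym (trans (instantiate-fun f cs (letVars bs))
                                          (cong (fun f) (instantiate-letVars cs)))) refl
          (ret (valᶠ f cs , fun-val f cs , ⟦val⟧ f cs)))
    computable {σ = σ} (ite L M N) {θ} {ρ} vs =
      conv (eval-ite _ _ _) refl (bind (computable L vs) λ V a v → conv (ite-wk _ _ (pure (base bool) v)) refl (branch v))
      where
      branch : ∀ {V a} → Val (base bool) V a →
               Computable (Val σ) (ite V (sub θ M) (sub θ N)) (if a then ⟦ M ⟧ ρ else ⟦ N ⟧ ρ)
      -- As denotations of constants are injective, a constant that denotes a truth value must be
      -- `ttᶜ` or `ffᶜ` itself.
      branch {a = true}  (c , V≐c , eq) with ⟦⟧ᶜ-injective (trans ⟦tt⟧ eq)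
      ... | refl = conv (≐-trans (cong-ite V≐c ≐-refl ≐-refl) (ite-tt _ _)) refl (computable M vs)
      branch {a = false} (c , V≐c , eq) with ⟦⟧ᶜ-injective (trans ⟦ff⟧ eq)
      ... | refl = conv (≐-trans (cong-ite V≐c ≐-refl ≐-refl) (ite-ff _ _)) refl (computable N vs)
    computable (M or N) vs = computable M vs or computable N vs
    computable (N · M) {θ} vs = conv (·-let _ _) refl (bind (computable N vs) λ where
      V a v@(c , V≐c , refl) → conv
        (≐-trans (β _ (pure (base rew) v)) (cong-· V≐c (≡⇒≐ (wk-single (sub θ M))))) refl
        (act c (computable M vs)))
    computable (M +[ p ] N) vs = computable M vs +[ p ] computable N vs
    computable ⋆ vs = ret ≐-refl
    computable (pair {σ} {τ} M N) {θ} vs = conv (eval-pair _ _) refl (bind (computable M vs) λ V a v →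
      conv (≐-trans (β _ (pure σ v))
                    (≡⇒≐ (cong (λ N′ → lett N′ (pair (wk V) v₀)) (wk-single (sub θ N)))))
        refl (bind (computable N vs) λ W b w →
          conv (≐-trans (β _ (pure τ w)) (≡⇒≐ (cong (λ V′ → pair V′ W) (wk-single V)))) refl
            (ret (V , W , ≐-refl , v , w))))
    computable (fst {σ} {τ} M) vs = conv (eval-fst _) refl (bind (computable M vs) λ where
      V a v@(V₁ , V₂ , V≐ , v₁ , v₂) → conv
        (≐-trans (β _ (pure (σ ⊗ τ) v)) (≐-trans (cong-fst V≐) (fst-pair (pure σ v₁) (pure τ v₂)))) refl
        (ret v₁))
    computable (snd {σ} {τ} M) vs = conv (eval-snd _) refl (bind (computable M vs) λ where
      V a v@(V₁ , V₂ , V≐ , v₁ , v₂) → conv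
        (≐-trans (β _ (pure (σ ⊗ τ) v)) (≐-trans (cong-snd V≐) (snd-pair (pure σ v₁) (pure τ v₂)))) refl
        (ret v₂))
    computable (lam {σ} M) {θ} vs = ret (lam-↓ _ , λ W a w → conv
      (≐-trans (β _ (pure σ w)) (≡⇒≐ (liftˢ-single θ W M))) refl
      (computable M (extend vs w)))
    computable (app {σ} {τ} M N) {θ} vs = conv (eval-app _ _) refl (bind (computable M vs) λ V f v →
      conv (≐-trans (β _ (pure (σ ⇒ τ) v))
                    (≡⇒≐ (cong (λ N′ → lett N′ (app (wk V) v₀)) (wk-single (sub θ N)))))
        refl (bind (computable N vs) λ W b w →
          conv (≐-trans (β _ (pure σ w)) (≡⇒≐ (cong (λ V′ → app V′ W) (wk-single V)))) refl
            (proj₂ v W b w)))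

    -- The continuation is arbitrary so that the induction on the arguments can absorb each
    -- evaluated constant into it.
    computable-lets : ∀ {Γ bs σ} (Ms : Args Γ bs) {θ : Subst Γ []} {ρ} → Vals θ ρ →
      {P : Program σ → ⟦ σ ⟧ᵗ → Set} {K : Tm ([] ▷ bs) σ} {f : All ⟦_⟧ᵇ bs → S ⟦ σ ⟧ᵗ} →
      (∀ cs → Computable P (instantiate cs K) (f (All.map ⟦_⟧ᶜ cs))) →
      Computable P (lets (subArgs θ Ms) K) ((f †) (⟦ Ms ⟧* ρ))
    computable-lets [] vs {f = f} k = conv ≐-refl (†-η f []) (k [])
    computable-lets {bs = b ∷ bs} (M ∷ Ms) {θ} {ρ} vs {P} {K} {f} k =
      conv ≐-refl flatten (bind (computable M vs) λ where
        V a v@(c , V≐c , refl) → conv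
          (≐-trans (cong-app ≐-refl V≐c) (≐-trans (β _ (con-↓ c)) (≡⇒≐
            (trans (sub-lets (single (con c)) (renArgs there (subArgs θ Ms)) K)
                   (cong (λ Ns → lets Ns (sub (liftsˢ bs (single (con c))) K)) (wkArgs-single _))))))
          refl
          (computable-lets Ms vs λ cs → k (c ∷ cs)))
      where
      -- Associativity moves `f` inside the two extensions that build the list of values.
      flatten : (f †) (⟦ M ∷ Ms ⟧* ρ) ≡ ((λ a → ((λ as → f (a ∷ as)) †) (⟦ Ms ⟧* ρ)) †) (⟦ M ⟧ ρ)
      flatten = trans
        (†-assocˢ (λ a → ((λ as → η (a ∷ as)) †) (⟦ Ms ⟧* ρ)) f (⟦ M ⟧ ρ))
        (cong (λ g → (g †) (⟦ M ⟧ ρ)) (ext λ a → trans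
          (†-assocˢ (λ as → η (a ∷ as)) f (⟦ Ms ⟧* ρ))
          (cong (λ g → (g †) (⟦ Ms ⟧* ρ)) (ext λ as → †-η f (a ∷ as)))))

-- Weights, mixtures and their right-nested sums.

module Mixtures (𝓡 : Reals) where
  open Reals 𝓡
  open RealLemmas 𝓡
  open UnitInterval 𝓡

  *-cancelˡ : ∀ {s x y} → s ≢ 0# → s * x ≡ s * y → x ≡ y
  *-cancelˡ {s} {x} {y} s≢0 eq = trans (sym (undo x)) (trans (cong (s ⁻¹ *_) eq) (undo y))
    where
    undo : ∀ z → s ⁻¹ * (s * z) ≡ z
    undo z = trans (sym (*-assoc _ s z)) (trans
      (cong (_* z) (trans (*-comm _ s) (*-inverseʳ s s≢0))) (*-identityˡ z))

  *-≢0 : ∀ {x y} → x ≢ 0# → y ≢ 0# → x * y ≢ 0#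
  *-≢0 {x} x≢0 y≢0 xy≡0 = y≢0 (*-cancelˡ x≢0 (trans xy≡0 (sym (zeroʳ x))))

  quotient-unique : ∀ {a c x} → c ≢ 0# → x * c ≡ a → a * c ⁻¹ ≡ x
  quotient-unique {c = c} {x} c≢0 refl =
    trans (*-assoc x c _) (trans (cong (x *_) (*-inverseʳ c c≢0)) (*-identityʳ x))

  quotient-* : ∀ {a c} → c ≢ 0# → a * c ⁻¹ * c ≡ a
  quotient-* {a} {c} c≢0 = trans (*-assoc a _ c)
    (trans (cong (a *_) (trans (*-comm _ c) (*-inverseʳ c c≢0))) (*-identityʳ a))

  𝕀-≡ : ∀ {p q : 𝕀} → val p ≡ val q → p ≡ q
  𝕀-≡ refl = refl

  1-p+p≡1 : ∀ p → val (1- p) + val p ≡ 1#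
  1-p+p≡1 p = y-x+x≡y (val p) 1#

  1-p≢0 : ∀ p → val p < 1# → val (1- p) ≢ 0#
  1-p≢0 p p<1 1-p≡0 = proj₂ p<1
    (trans (sym (+-identityˡ _)) (trans (cong (_+ val p) (sym 1-p≡0)) (1-p+p≡1 p)))

  1-interior : ∀ p → IsInterior p → IsInterior (1- p)
  1-interior p ((_ , 0≢p) , p<1) =
    (0≤val (1- p) , λ eq → 1-p≢0 p p<1 (sym eq)) , (val≤1 (1- p) , λ eq → 0≢p (sym (p≡0 eq)))
    where
    p≡0 : val (1- p) ≡ 1# → val p ≡ 0#
    p≡0 eq = begin
      val p                        ≡⟨ +-identityˡ _ ⟨
      0# + val p                   ≡⟨ cong (_+ val p) (-‿inverseˡ 1#) ⟨
      - 1# + 1# + val p            ≡⟨ +-assoc _ _ _ ⟩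
      - 1# + (1# + val p)          ≡⟨ cong (λ x → - 1# + (x + val p)) eq ⟨
      - 1# + (val (1- p) + val p)  ≡⟨ cong (- 1# +_) (1-p+p≡1 p) ⟩
      - 1# + 1#                    ≡⟨ -‿inverseˡ 1# ⟩
      0#                           ∎
      where open ≡-Reasoning

  -- Weight 0 is recorded as `1- p ≡ 1𝕀`, ready for commutativity followed by the unit law.
  endpoint : ∀ p → p ≡ 1𝕀 ⊎ 1- p ≡ 1𝕀 ⊎ IsInterior p
  endpoint p with val p ≟ 1# | val p ≟ 0#
  ... | yes p≡1 | _       = inj₁ (𝕀-≡ p≡1)
  ... | no _    | yes p≡0 = inj₂ (inj₁ (𝕀-≡ (begin
    1# - val p         ≡⟨ +-identityʳ _ ⟨
    1# - val p + 0#    ≡⟨ cong (1# - val p +_) p≡0 ⟨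
    1# - val p + val p ≡⟨ 1-p+p≡1 p ⟩
    1#                 ∎)))
    where open ≡-Reasoning
  ... | no p≢1  | no p≢0  = inj₂ (inj₂ ((0≤val p , p≢0 ∘ sym) , (val≤1 p , p≢1)))

  *𝕀-<1 : ∀ p q → val q < 1# → val (p *𝕀 q) < 1#
  *𝕀-<1 p q (q≤1 , q≢1) =
    val≤1 (p *𝕀 q) , λ pq≡1 → q≢1 (≤-antisym q≤1 (subst (_≤ val q) pq≡1 (*≤ʳ p q)))

  *𝕀-interior : ∀ p q → IsInterior p → IsInterior q → IsInterior (p *𝕀 q)
  *𝕀-interior p q ((_ , 0≢p) , _) ((_ , 0≢q) , q<1) =
    (0≤val (p *𝕀 q) , λ eq → *-≢0 (0≢p ∘ sym) (0≢q ∘ sym) (sym eq)) , *𝕀-<1 p q q<1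

  -- If (1-p)q/(1-pq) were 1, then q = (1-p)q + pq would equal (1-pq) + pq = 1.
  reweigh-<1 : ∀ p q (p<1 : val p < 1#) (q<1 : val q < 1#) → val (reweigh p q p<1 q<1) < 1#
  reweigh-<1 p q p<1 q<1 = val≤1 (reweigh p q p<1 q<1) , λ eq → proj₂ q<1 (q≡1 eq)
    where
    c≢0 : 1# - val p * val q ≢ 0#
    c≢0 = 1-pq≢0 p q q<1
    q≡1 : val (1- p) * val q * (1# - val p * val q) ⁻¹ ≡ 1# → val q ≡ 1#
    q≡1 eq = begin
      val q                                 ≡⟨ *-identityˡ _ ⟨
      1# * val q                            ≡⟨ cong (_* val q) (1-p+p≡1 p) ⟨
      (val (1- p) + val p) * val q          ≡⟨ distribʳ _ _ _ ⟩
      val (1- p) * val q + val p * val q    ≡⟨ cong (_+ val p * val q) (quotient-* c≢0) ⟨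
      val (1- p) * val q * (1# - val p * val q) ⁻¹ * (1# - val p * val q) + val p * val q
                                            ≡⟨ cong (λ x → x * (1# - val p * val q) + val p * val q) eq ⟩
      1# * (1# - val p * val q) + val p * val q
                                            ≡⟨ cong (_+ val p * val q) (*-identityˡ _) ⟩
      1# - val p * val q + val p * val q    ≡⟨ y-x+x≡y _ _ ⟩
      1#                                    ∎
      where open ≡-Reasoning

  sum-scale : ∀ s {n} (ps : Vec 𝕀 n) → sum (Vec.map (s *𝕀_) ps) ≡ val s * sum ps
  sum-scale s []       = sym (zeroʳ _)
  sum-scale s (p ∷ ps) = trans (cong (val s * val p +_) (sum-scale s ps)) (sym (distribˡ _ _ _))

  +-sum≢0 : ∀ p {n} (ps : Vec 𝕀 n) → sum ps ≢ 0# → val p + sum ps ≢ 0#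
  +-sum≢0 p ps ∑≢0 eq = ∑≢0 (≤-antisym
    (subst (sum ps ≤_) (trans (+-comm (sum ps) (val p)) eq) (x≤x+y (0≤val p))) (0≤sum ps))

  -- Only the ratios of weights enter `iterate`, and a common nonzero factor cancels in them.
  iterate-scale : ∀ {A : Set} (_+[_]_ : A → 𝕀 → A → A) s → val s ≢ 0# →
                  ∀ {n} (ps : Vec 𝕀 (suc n)) (xs : Vec A (suc n)) →
                  iterate _+[_]_ (Vec.map (s *𝕀_) ps) xs ≡ iterate _+[_]_ ps xs
  iterate-scale _+[_]_ s s≢0 {zero}  (_ ∷ [])  (x ∷ []) = refl
  iterate-scale _+[_]_ s s≢0 {suc n} (p ∷ ps)  (x ∷ xs)
    with sum (Vec.map (s *𝕀_) ps) ≟ 0# | sum ps ≟ 0#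
  ... | yes _   | yes _   = refl
  ... | yes ≡0  | no ∑≢0  = contradiction (trans (sym (sum-scale s ps)) ≡0) (*-≢0 s≢0 ∑≢0)
  ... | no ≢0   | yes ∑≡0 =
    contradiction (trans (sum-scale s ps) (trans (cong (val s *_) ∑≡0) (zeroʳ _))) ≢0
  ... | no _    | no ∑≢0  = cong₂ (x +[_]_) (𝕀-≡ same-ratio) (iterate-scale _+[_]_ s s≢0 ps xs)
    where
    c = val p + sum ps
    c≢0 : c ≢ 0#
    c≢0 = +-sum≢0 p ps ∑≢0
    scaled : val s * val p + sum (Vec.map (s *𝕀_) ps) ≡ val s * c
    scaled = trans (cong (val s * val p +_) (sum-scale s ps)) (sym (distribˡ _ _ _))
    same-ratio : val s * val p * (val s * val p + sum (Vec.map (s *𝕀_) ps)) ⁻¹ ≡ val p * c ⁻¹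
    same-ratio = trans (cong (λ d → val s * val p * d ⁻¹) scaled)
      (quotient-unique (*-≢0 s≢0 c≢0) (begin
        val p * c ⁻¹ * (val s * c)  ≡⟨ cong (val p * c ⁻¹ *_) (*-comm _ _) ⟩
        val p * c ⁻¹ * (c * val s)  ≡⟨ *-assoc _ _ _ ⟨
        val p * c ⁻¹ * c * val s    ≡⟨ cong (_* val s) (quotient-* c≢0) ⟩
        val p * val s               ≡⟨ *-comm _ _ ⟩
        val s * val p               ∎))
      where open ≡-Reasoning

  -- Parametricity of `iterate` in the operation. It will relate expectation terms to constants, and
  -- constants to rewards.
  iterate-rel : ∀ {A B C : Set} {_+ᴮ[_]_ : B → 𝕀 → B → B} {_+ᶜ[_]_ : C → 𝕀 → C → C}
                  (_~_ : B → C → Set) →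
                (∀ p {x y x′ y′} → x ~ x′ → y ~ y′ → (x +ᴮ[ p ] y) ~ (x′ +ᶜ[ p ] y′)) →
                {f : A → B} {g : A → C} → (∀ a → f a ~ g a) →
                ∀ {n} (ps : Vec 𝕀 (suc n)) (as : Vec A (suc n)) →
                iterate _+ᴮ[_]_ ps (Vec.map f as) ~ iterate _+ᶜ[_]_ ps (Vec.map g as)
  iterate-rel _~_ +~ f~g {zero}  (_ ∷ []) (a ∷ []) = f~g a
  iterate-rel _~_ +~ f~g {suc n} (p ∷ ps) (a ∷ as) with sum ps ≟ 0#
  ... | yes _ = f~g a
  ... | no  _ = +~ _ (f~g a) (iterate-rel _~_ +~ f~g ps as)

  -- Weights are interior because the order equivalence `+[]-≤-⇔` is available for these alone; the
  -- endpoints are removed by `normalise-+[]`.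
  data Mixture (A : Set) : Set where
    pure : A → Mixture A
    mix  : (p : 𝕀) → IsInterior p → Mixture A → Mixture A → Mixture A

  mapᴹ : ∀ {A B} → (A → B) → Mixture A → Mixture B
  mapᴹ f (pure a)      = pure (f a)
  mapᴹ f (mix p i l r) = mix p i (mapᴹ f l) (mapᴹ f r)

  fold : ∀ {A B : Set} → (B → 𝕀 → B → B) → (A → B) → Mixture A → B
  fold _+[_]_ f (pure a)      = f a
  fold _+[_]_ f (mix p i l r) = fold _+[_]_ f l +[ p ] fold _+[_]_ f r

  fold-rel : ∀ {A B C : Set} {_+ᴮ[_]_ : B → 𝕀 → B → B} {_+ᶜ[_]_ : C → 𝕀 → C → C}
               (_~_ : B → C → Set) →
             (∀ p → IsInterior p → ∀ {x y x′ y′} → x ~ x′ → y ~ y′ → (x +ᴮ[ p ] y) ~ (x′ +ᶜ[ p ] y′)) →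
             {f : A → B} {g : A → C} → (∀ a → f a ~ g a) →
             ∀ E → fold _+ᴮ[_]_ f E ~ fold _+ᶜ[_]_ g E
  fold-rel _~_ +~ f~g (pure a)      = f~g a
  fold-rel _~_ +~ f~g (mix p i l r) = +~ p i (fold-rel _~_ +~ f~g l) (fold-rel _~_ +~ f~g r)

  fold-mapᴹ : ∀ {A B C : Set} (_+[_]_ : C → 𝕀 → C → C) (g : B → C) (f : A → B) E →
              fold _+[_]_ g (mapᴹ f E) ≡ fold _+[_]_ (g ∘ f) E
  fold-mapᴹ _+[_]_ g f (pure a)      = refl
  fold-mapᴹ _+[_]_ g f (mix p i l r) = cong₂ _+[ p ]_ (fold-mapᴹ _+[_]_ g f l) (fold-mapᴹ _+[_]_ g f r)

  Allᴹ : ∀ {A : Set} → (A → Set) → Mixture A → Set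
  Allᴹ P (pure a)      = P a
  Allᴹ P (mix _ _ l r) = Allᴹ P l × Allᴹ P r

  Allᴹ-map : ∀ {A : Set} {P Q : A → Set} → (∀ {a} → P a → Q a) → ∀ E → Allᴹ P E → Allᴹ Q E
  Allᴹ-map f (pure a)      p       = f p
  Allᴹ-map f (mix _ _ l r) (p , q) = Allᴹ-map f l p , Allᴹ-map f r q

  -- The right-nested shape of ∑; the weights are those of the successive
  -- binary sums, so they are already renormalised.
  data Comb (A : Set) : Set where
    last : A → Comb A
    cons : A → (p : 𝕀) → val p < 1# → Comb A → Comb A

  -- Appends the second sum by barycentric associativity, read from left to right; the new weights
  -- are the ones in that law.
  mixᶜ : ∀ {A} → Comb A → (q : 𝕀) → val q < 1# → Comb A → Comb A
  mixᶜ (last a)         q q<1 D = cons a q q<1 D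
  mixᶜ (cons a p p<1 C) q q<1 D =
    cons a (p *𝕀 q) (*𝕀-<1 p q q<1) (mixᶜ C (reweigh p q p<1 q<1) (reweigh-<1 p q p<1 q<1) D)

  toComb : ∀ {A} → Mixture A → Comb A
  toComb (pure a)      = last a
  toComb (mix p i l r) = mixᶜ (toComb l) p (proj₂ i) (toComb r)

  size : ∀ {A} → Comb A → ℕ
  size (last _)       = zero
  size (cons _ _ _ C) = suc (size C)

  leaves : ∀ {A} (C : Comb A) → Vec A (suc (size C))
  leaves (last a)       = a ∷ []
  leaves (cons a _ _ C) = a ∷ leaves C

  -- Absolute weights: the factor `1- p` on the later leaves undoes the renormalisation in `cons`.
  leafWeights : ∀ {A} (C : Comb A) → Vec 𝕀 (suc (size C))
  leafWeights (last _)       = 1𝕀 ∷ []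
  leafWeights (cons _ p _ C) = p ∷ Vec.map ((1- p) *𝕀_) (leafWeights C)

  sum-leafWeights : ∀ {A} (C : Comb A) → sum (leafWeights C) ≡ 1#
  sum-scaled : ∀ {A} p (C : Comb A) → sum (Vec.map ((1- p) *𝕀_) (leafWeights C)) ≡ val (1- p)
  sum-leafWeights (last _)       = +-identityʳ 1#
  sum-leafWeights (cons _ p _ C) =
    trans (cong (val p +_) (sum-scaled p C)) (trans (+-comm _ _) (1-p+p≡1 p))
  sum-scaled p C = trans (sum-scale (1- p) (leafWeights C))
    (trans (cong (val (1- p) *_) (sum-leafWeights C)) (*-identityʳ _))

  toWeights : ∀ {A} (C : Comb A) → Weights (size C)
  toWeights C = mkWeights (leafWeights C) (sum-leafWeights C)

  foldᶜ : ∀ {A B : Set} → (B → 𝕀 → B → B) → (A → B) → Comb A → B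
  foldᶜ _+[_]_ f (last a)       = f a
  foldᶜ _+[_]_ f (cons a p _ C) = f a +[ p ] foldᶜ _+[_]_ f C

  -- The weights add up to 1, so `∑` divides the first one by 1 and leaves `p`; in the rest the
  -- common factor `1- p` cancels by `iterate-scale`.
  foldᶜ-∑ : ∀ {A B : Set} (_+[_]_ : B → 𝕀 → B → B) (f : A → B) (C : Comb A) →
            foldᶜ _+[_]_ f C ≡ ∑ _+[_]_ (toWeights C) (Vec.map f (leaves C))
  foldᶜ-∑ _+[_]_ f (last a) = refl
  foldᶜ-∑ _+[_]_ f (cons a p p<1 C) with sum (Vec.map ((1- p) *𝕀_) (leafWeights C)) ≟ 0#
  ... | yes eq = contradiction (trans (sym (sum-scaled p C)) eq) (1-p≢0 p p<1)
  ... | no  _  = cong₂ (f a +[_]_) (𝕀-≡ (sym ratio≡p))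
    (trans (foldᶜ-∑ _+[_]_ f C) (sym (iterate-scale _+[_]_ (1- p) (1-p≢0 p p<1) (leafWeights C) _)))
    where
    ratio≡p : val p * (val p + sum (Vec.map ((1- p) *𝕀_) (leafWeights C))) ⁻¹ ≡ val p
    ratio≡p = quotient-unique (λ eq → 0≢1 (trans (sym eq) (sum-leafWeights (cons a p p<1 C))))
      (trans (cong (val p *_) (sum-leafWeights (cons a p p<1 C))) (*-identityʳ _))

  -- The equivalence is a parameter since the passage to `∑` is made twice: up to provable equality
  -- for programs, and up to equality for rewards.
  module _ {A B : Set} (_+[_]_ : B → 𝕀 → B → B) (_≈_ : B → B → Set) (isEquivalence : IsEquivalence _≈_)
           (+[]-cong : ∀ p {x x′ y y′} → x ≈ x′ → y ≈ y′ → (x +[ p ] y) ≈ (x′ +[ p ] y′))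
           (+[]-assoc : ∀ p q (p<1 : val p < 1#) (q<1 : val q < 1#) x y z →
                        ((x +[ p ] y) +[ q ] z) ≈ (x +[ p *𝕀 q ] (y +[ reweigh p q p<1 q<1 ] z)))
           (f : A → B) where
    private module ≈ = IsEquivalence isEquivalence

    foldᶜ-mixᶜ : ∀ C q q<1 D → (foldᶜ _+[_]_ f C +[ q ] foldᶜ _+[_]_ f D) ≈ foldᶜ _+[_]_ f (mixᶜ C q q<1 D)
    foldᶜ-mixᶜ (last a)         q q<1 D = ≈.refl
    foldᶜ-mixᶜ (cons a p p<1 C) q q<1 D = ≈.trans (+[]-assoc p q p<1 q<1 _ _ _)
      (+[]-cong _ ≈.refl (foldᶜ-mixᶜ C _ (reweigh-<1 p q p<1 q<1) D))

    fold-foldᶜ : ∀ E → fold _+[_]_ f E ≈ foldᶜ _+[_]_ f (toComb E)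
    fold-foldᶜ (pure a)      = ≈.refl
    fold-foldᶜ (mix p i l r) =
      ≈.trans (+[]-cong p (fold-foldᶜ l) (fold-foldᶜ r)) (foldᶜ-mixᶜ (toComb l) p (proj₂ i) (toComb r))

    fold-∑ : ∀ E → fold _+[_]_ f E ≈
             ∑ _+[_]_ (toWeights (toComb E)) (Vec.map f (leaves (toComb E)))
    fold-∑ E = ≈.trans (fold-foldᶜ E) (≈.reflexive (foldᶜ-∑ _+[_]_ f (toComb E)))

-- Monotonicity laws for rewards.

module RewardOrder (𝓡 : Reals) (Rw : Rewards 𝓡) where
  open UnitInterval 𝓡
  open Mixtures 𝓡
  open Rewards Rw
  open IsBarycentric isBarycentric public
  open IsCommutativeMonoid isCommutativeMonoid public using ()
    renaming (comm to +-comm; identityˡ to +-identityˡ; identityʳ to +-identityʳ)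
  open IsDecTotalOrder isDecTotalOrder public using ()
    renaming (refl to ≤-refl; reflexive to ≤-reflexive; trans to ≤-trans; antisym to ≤-antisym
             ; total to ≤-total; _≟_ to _≟ᴿ_)

  +-≤ˡ-⇔ : ∀ r s t → (r ≤ s) ⇔ (t + r ≤ t + s)
  +-≤ˡ-⇔ r s t = subst₂ (λ x y → (r ≤ s) ⇔ (x ≤ y)) (+-comm r t) (+-comm s t) (+-≤-⇔ r s t)

  +[]-≤ˡ-⇔ : ∀ p → IsInterior p → ∀ r s t → (r ≤ s) ⇔ (t +[ p ] r ≤ t +[ p ] s)
  +[]-≤ˡ-⇔ p i r s t = subst₂ (λ x y → (r ≤ s) ⇔ (x ≤ y)) (sym (comm p t r)) (sym (comm p t s))
    (+[]-≤-⇔ (1- p) (1-interior p i) r s t)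

  +-mono-≤ : ∀ {r r′ s s′} → r ≤ r′ → s ≤ s′ → r + s ≤ r′ + s′
  +-mono-≤ {r} {r′} {s} {s′} r≤r′ s≤s′ =
    ≤-trans (Equivalence.to (+-≤-⇔ r r′ s) r≤r′) (Equivalence.to (+-≤ˡ-⇔ s s′ r′) s≤s′)

  +[]-mono-≤ : ∀ p → IsInterior p → ∀ {r r′ s s′} → r ≤ r′ → s ≤ s′ → r +[ p ] s ≤ r′ +[ p ] s′
  +[]-mono-≤ p i {r} {r′} {s} {s′} r≤r′ s≤s′ =
    ≤-trans (Equivalence.to (+[]-≤-⇔ p i r r′ s) r≤r′) (Equivalence.to (+[]-≤ˡ-⇔ p i s s′ r′) s≤s′)

  +-distribʳ : ∀ p s s′ r → (s +[ p ] s′) + r ≡ (s + r) +[ p ] (s′ + r)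
  +-distribʳ p s s′ r = trans (+-comm _ r) (trans (+-distribˡ p r s s′)
    (cong₂ (_+[ p ]_) (+-comm r s) (+-comm r s′)))

-- Normal forms at base types: choices among mixtures.

data Choice (A : Set) : Set where
  one  : A → Choice A
  _or_ : Choice A → Choice A → Choice A

mapᶜ : ∀ {A B} → (A → B) → Choice A → Choice B
mapᶜ f (one a)  = one (f a)
mapᶜ f (M or N) = mapᶜ f M or mapᶜ f N

Allᶜ : ∀ {A : Set} → (A → Set) → Choice A → Set
Allᶜ P (one a)  = P a
Allᶜ P (M or N) = Allᶜ P M × Allᶜ P N

Allᶜ-map : ∀ {A : Set} {P Q : A → Set} → (∀ {a} → P a → Q a) → (N : Choice A) → Allᶜ P N → Allᶜ Q N
Allᶜ-map f (one a)  p       = f p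
Allᶜ-map f (M or N) (p , q) = Allᶜ-map f M p , Allᶜ-map f N q

module NormalForm (ext : Extensionality 0ℓ 0ℓ)
    (𝓡 : Reals) (Sig : Signature 𝓡) (Rw : Rewards 𝓡)
    (I : Interpretation 𝓡 Sig Rw) (𝓣 : AuxiliaryMonad 𝓡 Rw)
    (Ax : Language.Theory 𝓡 Sig) (Ax₁⊑Ax : Language._⊑_ 𝓡 Sig (Language.Ax₁ 𝓡 Sig) Ax) where
  open Language 𝓡 Sig
  open Substitution 𝓡 Sig
  open Derivability 𝓡 Sig Ax
  open Semantics 𝓡 Sig Rw I 𝓣
  open SelectionMonad ext 𝓡 Sig Rw I 𝓣
  open Computability ext 𝓡 Sig Rw I 𝓣 Ax
    using (Computable; ret; _or_; act; _+[_]_; conv; Val)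
  open Interpretation I
  open Mixtures 𝓡
  open Rewards Rw using (R; _≤?_; _≤_; _+_; +[]-≤-⇔)
  open RewardOrder 𝓡 Rw using (+-≤ˡ-⇔; +[]-≤ˡ-⇔)
  open AuxiliaryMonad 𝓣 using (T; isModule)
    renaming (η to ηᵀ; _·_ to _·ᵀ_; _+[_]_ to _+ᵀ[_]_; †-idˡ to †ᵀ-idˡ)
  private
    module Module {X} = IsBarycentricModule (isModule X)
    module Barycentric {X} = IsBarycentric (Module.isBarycentric {X})

  ax₁ : ∀ {Γ} {A : Assertion Γ} → Ax₁ Γ A → Ax ⊢ A
  ax₁ a = axiom (Ax₁⊑Ax _ a)

  Leaf : BaseType → Set
  Leaf b = Con rew × Con b

  leafTerm : ∀ {b} → Leaf b → Program (base b)
  leafTerm (d , c) = con d · con c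

  mixtureTerm : ∀ {b} → Mixture (Leaf b) → Program (base b)
  mixtureTerm = fold _+[_]_ leafTerm

  choiceTerm : ∀ {b} → Choice (Mixture (Leaf b)) → Program (base b)
  choiceTerm (one E)  = mixtureTerm E
  choiceTerm (M or N) = choiceTerm M or choiceTerm N

  ⟦_⟧ᴸ : ∀ {b} → Leaf b → T ⟦ b ⟧ᵇ
  ⟦ d , c ⟧ᴸ = ⟦ d ⟧ᶜ ·ᵀ ηᵀ ⟦ c ⟧ᶜ

  -- Mixtures contain no `or`, so their denotations do not depend on the reward function and can be
  -- taken in `T`.
  ⟦_⟧ᴹ : ∀ {b} → Mixture (Leaf b) → T ⟦ b ⟧ᵇ
  ⟦_⟧ᴹ = fold _+ᵀ[_]_ ⟦_⟧ᴸ

  ⟦_⟧ᶜʰ : ∀ {b} → Choice (Mixture (Leaf b)) → S ⟦ b ⟧ᵇ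
  ⟦ one E  ⟧ᶜʰ = λ _ → ⟦ E ⟧ᴹ
  ⟦ M or N ⟧ᶜʰ = ⟦ M ⟧ᶜʰ orˢ ⟦ N ⟧ᶜʰ

  mixtureTerm-sound : ∀ {b} (E : Mixture (Leaf b)) → ⟦ mixtureTerm E ⟧ [] ≡ (λ _ → ⟦ E ⟧ᴹ)
  mixtureTerm-sound (pure (d , c)) = ext λ γ → †ᵀ-idˡ _ _
  mixtureTerm-sound (mix p i l r)  = cong₂ (_+ˢ[ p ]_) (mixtureTerm-sound l) (mixtureTerm-sound r)

  mixtureTerm-value : ∀ {b} (E : Mixture (Leaf b)) → PREffectValue (mixtureTerm E)
  mixtureTerm-value (pure (d , c)) = d · con c
  mixtureTerm-value (mix p i l r)  = mixtureTerm-value l +[ p ] mixtureTerm-value r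

  -- The axiom has a variable as reward; constants are pure and may be substituted for it. The laws
  -- `con-·-or` and `con-·-·` arise in the same way.
  con-·-+[] : ∀ d p {σ} (M N : Program σ) → Ax ⊢ con d · (M +[ p ] N) ≐ ((con d · M) +[ p ] (con d · N))
  con-·-+[] d p M N =
    subst₂ (λ M₁ N₁ → Ax ⊢ con d · (M₁ +[ p ] N₁) ≐ ((con d · M₁) +[ p ] (con d · N₁)))
      (wk-single M) (wk-single N)
      (substitution (con-↓ d) (ax₁ (·-+[] p (here refl) (wk M) (wk N))))

  con-·-or : ∀ d {σ} (M N : Program σ) → Ax ⊢ con d · (M or N) ≐ ((con d · M) or (con d · N))
  con-·-or d M N =
    subst₂ (λ M₁ N₁ → Ax ⊢ con d · (M₁ or N₁) ≐ ((con d · M₁) or (con d · N₁)))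
      (wk-single M) (wk-single N)
      (substitution (con-↓ d) (ax₁ (·-or (here refl) (wk M) (wk N))))

  _+ᶜ_ : Con rew → Con rew → Con rew
  d +ᶜ d′ = valᶠ +ᶠ (d ∷ d′ ∷ [])

  ⟦+ᶜ⟧ : ∀ d d′ → ⟦ d ⟧ᶜ + ⟦ d′ ⟧ᶜ ≡ ⟦ d +ᶜ d′ ⟧ᶜ
  ⟦+ᶜ⟧ d d′ = trans (sym (⟦+⟧ _ _)) (⟦val⟧ +ᶠ (d ∷ d′ ∷ []))

  con-·-· : ∀ d d′ {σ} (M : Program σ) → Ax ⊢ con d · (con d′ · M) ≐ (con (d +ᶜ d′) · M)
  con-·-· d d′ M = ≐-trans
    (subst (λ M₁ → Ax ⊢ con d · (con d′ · M₁) ≐ (fun +ᶠ (con d ∷ con d′ ∷ []) · M₁))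
      (trans (cong (_[ con d ]) (wk-single {N = con d′} (wk M))) (wk-single M))
      (substitution (con-↓ d) (substitution (con-↓ d′)
        (ax₁ (·-· (there (here refl)) (here refl) (wk (wk M)))))))
    (cong-· (fun-val +ᶠ (d ∷ d′ ∷ [])) ≐-refl)

  shift : ∀ {b} → Con rew → Mixture (Leaf b) → Mixture (Leaf b)
  shift d = mapᴹ λ (d′ , c) → d +ᶜ d′ , c

  shift-≐ : ∀ {b} d (E : Mixture (Leaf b)) → Ax ⊢ con d · mixtureTerm E ≐ mixtureTerm (shift d E)
  shift-≐ d (pure (d′ , c)) = con-·-· d d′ (con c)
  shift-≐ d (mix p i l r)   = ≐-trans (con-·-+[] d p _ _) (cong-+[] p (shift-≐ d l) (shift-≐ d r))

  shift-⟦⟧ : ∀ {b} d (E : Mixture (Leaf b)) → ⟦ d ⟧ᶜ ·ᵀ ⟦ E ⟧ᴹ ≡ ⟦ shift d E ⟧ᴹ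
  shift-⟦⟧ d (pure (d′ , c)) = trans (Module.·-· _ _ _) (cong (_·ᵀ ηᵀ ⟦ c ⟧ᶜ) (⟦+ᶜ⟧ d d′))
  shift-⟦⟧ d (mix p i l r)   = trans (Module.·-+[] _ p _ _)
    (cong₂ _+ᵀ[ p ]_ (shift-⟦⟧ d l) (shift-⟦⟧ d r))

  -- A map that preserves and reflects the order of rewards cannot change which alternative is
  -- selected. It is used with the action of a reward and with mixing on either side.
  orˢ-natural : ∀ {X} (k : (X → R) → T X → T X) →
                (∀ γ u v → (reward γ u ≤ reward γ v) ⇔ (reward γ (k γ u) ≤ reward γ (k γ v))) →
                ∀ F G → (λ γ → k γ ((F orˢ G) γ)) ≡ ((λ γ → k γ (F γ)) orˢ (λ γ → k γ (G γ)))
  orˢ-natural k k-order F G = ext pointwise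
    where
    pointwise : ∀ γ → k γ ((F orˢ G) γ) ≡ ((λ γ → k γ (F γ)) orˢ (λ γ → k γ (G γ))) γ
    pointwise γ
      -- The two tests become one Boolean, so that a single case split decides both.
      rewrite sym (does-⇔ (k-order γ (G γ) (F γ))
        (reward γ (G γ) ≤? reward γ (F γ)) (reward γ (k γ (G γ)) ≤? reward γ (k γ (F γ))))
      with does (reward γ (G γ) ≤? reward γ (F γ))
    ... | true  = refl
    ... | false = refl

  ·ˢ-or : ∀ {X} r (F G : S X) → r ·ˢ (F orˢ G) ≡ ((r ·ˢ F) orˢ (r ·ˢ G))
  ·ˢ-or r = orˢ-natural (λ _ → r ·ᵀ_) λ γ u v →
    subst₂ (λ x y → (reward γ u ≤ reward γ v) ⇔ (x ≤ y)) (sym (reward-· γ r u)) (sym (reward-· γ r v))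
      (+-≤ˡ-⇔ _ _ r)

  +ˢ-orʳ : ∀ {X} p → IsInterior p → (H F G : S X) →
           (H +ˢ[ p ] (F orˢ G)) ≡ ((H +ˢ[ p ] F) orˢ (H +ˢ[ p ] G))
  +ˢ-orʳ p i H = orˢ-natural (λ γ → H γ +ᵀ[ p ]_) λ γ u v →
    subst₂ (λ x y → (reward γ u ≤ reward γ v) ⇔ (x ≤ y))
      (sym (reward-+[] γ p _ u)) (sym (reward-+[] γ p _ v)) (+[]-≤ˡ-⇔ p i _ _ _)

  +ˢ-orˡ : ∀ {X} p → IsInterior p → (F G H : S X) →
           ((F orˢ G) +ˢ[ p ] H) ≡ ((F +ˢ[ p ] H) orˢ (G +ˢ[ p ] H))
  +ˢ-orˡ p i F G H = orˢ-natural (λ γ u → u +ᵀ[ p ] H γ) (λ γ u v →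
    subst₂ (λ x y → (reward γ u ≤ reward γ v) ⇔ (x ≤ y))
      (sym (reward-+[] γ p u _)) (sym (reward-+[] γ p v _)) (+[]-≤-⇔ p i _ _ _)) F G

  +[]-orˡ : ∀ p {σ} (M N L : Program σ) → Ax ⊢ ((M or N) +[ p ] L) ≐ ((M +[ p ] L) or (N +[ p ] L))
  +[]-orˡ p M N L = ≐-trans (ax₁ (+[]-comm p _ _)) (≐-trans (ax₁ (+[]-or (1- p) L M N))
    (cong-or (≐-sym (ax₁ (+[]-comm p _ _))) (≐-sym (ax₁ (+[]-comm p _ _)))))

  shiftᶜʰ-≐ : ∀ {b} d (N : Choice (Mixture (Leaf b))) →
              Ax ⊢ con d · choiceTerm N ≐ choiceTerm (mapᶜ (shift d) N)
  shiftᶜʰ-≐ d (one E)  = shift-≐ d E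
  shiftᶜʰ-≐ d (M or N) = ≐-trans (con-·-or d _ _) (cong-or (shiftᶜʰ-≐ d M) (shiftᶜʰ-≐ d N))

  shiftᶜʰ-⟦⟧ : ∀ {b} d (N : Choice (Mixture (Leaf b))) → ⟦ d ⟧ᶜ ·ˢ ⟦ N ⟧ᶜʰ ≡ ⟦ mapᶜ (shift d) N ⟧ᶜʰ
  shiftᶜʰ-⟦⟧ d (one E)  = ext λ _ → shift-⟦⟧ d E
  shiftᶜʰ-⟦⟧ d (M or N) = trans (·ˢ-or ⟦ d ⟧ᶜ ⟦ M ⟧ᶜʰ ⟦ N ⟧ᶜʰ)
    (cong₂ _orˢ_ (shiftᶜʰ-⟦⟧ d M) (shiftᶜʰ-⟦⟧ d N))

  mixᶜʰ : ∀ {b} p → IsInterior p →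
          Choice (Mixture (Leaf b)) → Choice (Mixture (Leaf b)) → Choice (Mixture (Leaf b))
  mixᶜʰ p i (M or N) L        = mixᶜʰ p i M L or mixᶜʰ p i N L
  mixᶜʰ p i (one E)  (M or N) = mixᶜʰ p i (one E) M or mixᶜʰ p i (one E) N
  mixᶜʰ p i (one E)  (one E′) = one (mix p i E E′)

  mixᶜʰ-≐ : ∀ {b} p i (M N : Choice (Mixture (Leaf b))) →
            Ax ⊢ (choiceTerm M +[ p ] choiceTerm N) ≐ choiceTerm (mixᶜʰ p i M N)
  mixᶜʰ-≐ p i (M or N) L        = ≐-trans (+[]-orˡ p _ _ _) (cong-or (mixᶜʰ-≐ p i M L) (mixᶜʰ-≐ p i N L))
  mixᶜʰ-≐ p i (one E)  (M or N) =
    ≐-trans (ax₁ (+[]-or p _ _ _)) (cong-or (mixᶜʰ-≐ p i (one E) M) (mixᶜʰ-≐ p i (one E) N))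
  mixᶜʰ-≐ p i (one E)  (one E′) = ≐-refl

  mixᶜʰ-⟦⟧ : ∀ {b} p i (M N : Choice (Mixture (Leaf b))) →
             (⟦ M ⟧ᶜʰ +ˢ[ p ] ⟦ N ⟧ᶜʰ) ≡ ⟦ mixᶜʰ p i M N ⟧ᶜʰ
  mixᶜʰ-⟦⟧ p i (M or N) L        = trans (+ˢ-orˡ p i ⟦ M ⟧ᶜʰ ⟦ N ⟧ᶜʰ ⟦ L ⟧ᶜʰ)
    (cong₂ _orˢ_ (mixᶜʰ-⟦⟧ p i M L) (mixᶜʰ-⟦⟧ p i N L))
  mixᶜʰ-⟦⟧ p i (one E)  (M or N) = trans (+ˢ-orʳ p i (λ _ → ⟦ E ⟧ᴹ) ⟦ M ⟧ᶜʰ ⟦ N ⟧ᶜʰ)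
    (cong₂ _orˢ_ (mixᶜʰ-⟦⟧ p i (one E) M) (mixᶜʰ-⟦⟧ p i (one E) N))
  mixᶜʰ-⟦⟧ p i (one E)  (one E′) = refl

  HasNormalForm : ∀ {b} → Program (base b) → S ⟦ b ⟧ᵇ → Set
  HasNormalForm M F = ∃ λ N → (Ax ⊢ M ≐ choiceTerm N) × F ≡ ⟦ N ⟧ᶜʰ

  -- At weight 1 or 0 the unit law discards an operand; at an interior weight the mixture is
  -- distributed over both choices.
  normalise-+[] : ∀ {b} {M N : Program (base b)} {F G} p →
                  HasNormalForm M F → HasNormalForm N G → HasNormalForm (M +[ p ] N) (F +ˢ[ p ] G)
  normalise-+[] {M = M} {N} {F} {G} p (M′ , M≐ , F≡) (N′ , N≐ , G≡) with endpoint p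
  ... | inj₁ refl = M′ , ≐-trans (ax₁ (+[]-unit M N)) M≐ , trans (ext λ _ → Barycentric.unit _ _) F≡
  ... | inj₂ (inj₁ 1-p≡1) = N′ ,
    ≐-trans (ax₁ (+[]-comm p M N)) (≐-trans (≡⇒≐ (cong (N +[_] M) 1-p≡1))
      (≐-trans (ax₁ (+[]-unit N M)) N≐)) ,
    trans (ext λ γ → trans (Barycentric.comm p _ _)
      (trans (cong (G γ +ᵀ[_] F γ) 1-p≡1) (Barycentric.unit _ _))) G≡
  ... | inj₂ (inj₂ i) = mixᶜʰ p i M′ N′ , ≐-trans (cong-+[] p M≐ N≐) (mixᶜʰ-≐ p i M′ N′) ,
    trans (cong₂ _+ˢ[ p ]_ F≡ G≡) (mixᶜʰ-⟦⟧ p i M′ N′)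

  normalise : ∀ {b} {M : Program (base b)} {F} → Computable (Val (base b)) M F → HasNormalForm M F
  -- Each leaf carries a reward; a bare constant receives the neutral one.
  normalise (ret (c , V≐c , refl)) = one (pure (0ᶜ , c)) , ≐-trans V≐c (≐-sym (ax₁ (·-zero (con c)))) ,
    ext λ _ → sym (trans (cong (_·ᵀ ηᵀ ⟦ c ⟧ᶜ) ⟦0⟧) (Module.·-zero _))
  normalise (c or d) = let (M , M≐ , F≡) = normalise c ; (N , N≐ , G≡) = normalise d in
    M or N , cong-or M≐ N≐ , cong₂ _orˢ_ F≡ G≡
  normalise (act d c) = let (M , M≐ , F≡) = normalise c in
    mapᶜ (shift d) M , ≐-trans (cong-· ≐-refl M≐) (shiftᶜʰ-≐ d M) ,
    trans (cong (⟦ d ⟧ᶜ ·ˢ_) F≡) (shiftᶜʰ-⟦⟧ d M)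
  normalise (c +[ p ] d) = normalise-+[] p (normalise c) (normalise d)
  normalise (conv M≐N F≡G c) = let (N′ , N≐ , G≡) = normalise c in
    N′ , ≐-trans M≐N N≐ , trans F≡G G≡

-- Separating mixtures by reward functions.

-- Rewards of mixtures are viewed as functions of the rewards l and r
-- that are assigned to the returned value a and to all other values.
module Separation (𝓡 : Reals) (Rw : Rewards 𝓡) (conditionC : Rewards.ConditionC Rw)
    (nonzero : ∃ λ x → x ≢ Rewards.0# Rw) where
  open UnitInterval 𝓡
  open Mixtures 𝓡
  open Rewards Rw
  open RewardOrder 𝓡 Rw

  AtLeast : R → (R → R → R) → Set
  AtLeast s ρ = ∀ {l r} → l ≤ r → s + l ≤ ρ l r

  -- Up to the error `s`, the reward is at least what results when all of the mass, or a fixed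
  -- proportion `p` of it, is rewarded with `r` and the rest with `l`.
  Escapes : R → (R → R → R) → Set
  Escapes s ρ = (∀ {l r} → l ≤ r → s + r ≤ ρ l r) ⊎
    (∃ λ p → IsInterior p × (∀ {l r} → l ≤ r → s + (r +[ p ] l) ≤ ρ l r))

  AtLeast-+[] : ∀ {s ρ₁ ρ₂} q → IsInterior q → AtLeast s ρ₁ → AtLeast s ρ₂ →
                AtLeast s (λ l r → ρ₁ l r +[ q ] ρ₂ l r)
  AtLeast-+[] q i f g l≤r = subst (_≤ _) (idem q _) (+[]-mono-≤ q i (f l≤r) (g l≤r))

  -- Of the other operand only the bound `s + l` is used. Distributivity extracts `s`, and in the
  -- second case associativity and idempotence merge the two occurrences of `l`, leaving `r` with
  -- weight `p *𝕀 q`.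
  Escapes-+[]ˡ : ∀ {s ρ₁ ρ₂} q → IsInterior q → Escapes s ρ₁ → AtLeast s ρ₂ →
                 Escapes s (λ l r → ρ₁ l r +[ q ] ρ₂ l r)
  Escapes-+[]ˡ q i (inj₁ f) g = inj₂ (q , i , λ l≤r →
    subst (_≤ _) (sym (+-distribˡ q _ _ _)) (+[]-mono-≤ q i (f l≤r) (g l≤r)))
  Escapes-+[]ˡ {s} q i (inj₂ (p , j , f)) g = inj₂ (p *𝕀 q , *𝕀-interior p q j i , λ {l} {r} l≤r →
    subst (_≤ _) (collect l r) (+[]-mono-≤ q i (f l≤r) (g l≤r)))
    where
    collect : ∀ l r → (s + (r +[ p ] l)) +[ q ] (s + l) ≡ s + (r +[ p *𝕀 q ] l)
    collect l r = trans (sym (+-distribˡ q _ _ _)) (cong (s +_)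
      (trans (assoc p q (proj₂ j) (proj₂ i) r l l) (cong (r +[ p *𝕀 q ]_) (idem _ l))))

  Escapes-+[]ʳ : ∀ {s ρ₁ ρ₂} q → IsInterior q → AtLeast s ρ₁ → Escapes s ρ₂ →
                 Escapes s (λ l r → ρ₁ l r +[ q ] ρ₂ l r)
  Escapes-+[]ʳ {s} {ρ₁} {ρ₂} q i f g with Escapes-+[]ˡ (1- q) (1-interior q i) g f
  ... | inj₁ h           = inj₁ λ l≤r → ≤-trans (h l≤r) (≤-reflexive (sym (comm q _ _)))
  ... | inj₂ (p , j , h) = inj₂ (p , j , λ l≤r → ≤-trans (h l≤r) (≤-reflexive (sym (comm q _ _))))

  distinct : ∃₂ λ l r → l < r
  distinct with ≤-total 0# (proj₁ nonzero)
  ... | inj₁ 0≤x = 0# , _ , (0≤x , proj₂ nonzero ∘ sym)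
  ... | inj₂ x≤0 = _ , 0# , (x≤0 , proj₂ nonzero)

  -- For `s = 0` any two distinct rewards give a contradiction. For `s < 0` the rewards must
  -- outweigh the error `s`, which is what condition (C) provides in the mixed case.
  ¬bounded : ∀ {s ρ} → s ≤ 0# → Escapes s ρ → ¬ (∀ l r → ρ l r ≤ l)
  ¬bounded {s} {ρ} s≤0 esc ρ≤l with s ≟ᴿ 0#
  ¬bounded {s} {ρ} s≤0 (inj₁ f) ρ≤l | yes refl =
    let (l , r , l≤r , l≢r) = distinct in
    l≢r (≤-antisym l≤r (subst (_≤ l) (+-identityˡ r) (≤-trans (f l≤r) (ρ≤l l r))))
  ¬bounded {s} {ρ} s≤0 (inj₂ (p , i , f)) ρ≤l | yes refl =
    let (l , r , l≤r , l≢r) = distinct in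
    -- By idempotence the bound reads `r +[ p ] l ≤ l +[ p ] l`, from which `l` cancels.
    l≢r (≤-antisym l≤r (Equivalence.from (+[]-≤-⇔ p i r l l)
      (subst₂ _≤_ (+-identityˡ _) (sym (idem p l)) (≤-trans (f l≤r) (ρ≤l l r)))))
  -- With `l = s + s` and `r = 0#` the bound becomes `s + 0# ≤ s + s`, forcing `0# ≤ s`.
  ¬bounded {s} {ρ} s≤0 (inj₁ f) ρ≤l | no s≢0 =
    s≢0 (≤-antisym s≤0 (Equivalence.from (+-≤ˡ-⇔ 0# s s)
      (≤-trans (f (subst (s + s ≤_) (+-identityˡ 0#) (+-mono-≤ s≤0 s≤0))) (ρ≤l (s + s) 0#))))
  ¬bounded {s} {ρ} s≤0 (inj₂ (p , i , f)) ρ≤l | no s≢0 with conditionC p i s (s≤0 , s≢0)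
  ... | l , r , l≤ , l≢ with ≤-total l r
  ...   | inj₁ l≤r = l≢ (≤-antisym l≤ (≤-trans (f l≤r) (ρ≤l l r)))
  -- Condition (C) does not assert `l ≤ r`, but `r ≤ l` would give `s + (r +[ p ] l) ≤ l` because
  -- `s ≤ 0#`.
  ...   | inj₂ r≤l = l≢ (≤-antisym l≤ (subst₂ _≤_ refl (+-identityˡ l)
          (+-mono-≤ s≤0 (≤-trans (+[]-mono-≤ p i r≤l ≤-refl) (≤-reflexive (idem p l))))))

-- Rewards of the alternatives of a pure program.

module PurityCompleteness (em : ExcludedMiddle 0ℓ) (ext : Extensionality 0ℓ 0ℓ)
    (𝓡 : Reals) (Sig : Signature 𝓡) (Rw : Rewards 𝓡)
    (I : Interpretation 𝓡 Sig Rw) (𝓣 : AuxiliaryMonad 𝓡 Rw)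
    (conditionC : Rewards.ConditionC Rw)
    (Ax : Language.Theory 𝓡 Sig) (Ax₁⊑Ax : Language._⊑_ 𝓡 Sig (Language.Ax₁ 𝓡 Sig) Ax) where
  open Language 𝓡 Sig
  open Substitution 𝓡 Sig using (sub-id)
  open Derivability 𝓡 Sig Ax using (≡⇒≐)
  open Semantics 𝓡 Sig Rw I 𝓣
  open SelectionMonad ext 𝓡 Sig Rw I 𝓣
  open Computability ext 𝓡 Sig Rw I 𝓣 Ax using (computable)
  open NormalForm ext 𝓡 Sig Rw I 𝓣 Ax Ax₁⊑Ax
  open Interpretation I
  open Mixtures 𝓡
  open Rewards Rw using (R; _≤?_; _≤_; _+_; +-≤-⇔)
    renaming (_+[_]_ to _+ᴿ[_]_; 0# to 0ᴿ)
  open RewardOrder 𝓡 Rw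
  open Separation 𝓡 Rw conditionC (⟦ proj₁ nonzero ⟧ᶜ , proj₂ nonzero)
  open AuxiliaryMonad 𝓣 using (T) renaming (η to ηᵀ)

  expected : ∀ {b} → (⟦ b ⟧ᵇ → R) → Mixture (Leaf b) → R
  expected γ = fold _+ᴿ[_]_ λ (d , c) → ⟦ d ⟧ᶜ + γ ⟦ c ⟧ᶜ

  reward-expected : ∀ {b} (γ : ⟦ b ⟧ᵇ → R) E → reward γ (⟦_⟧ᴹ {b} E) ≡ expected {b} γ E
  reward-expected {b} γ = fold-rel (λ (u : T ⟦ b ⟧ᵇ) r → reward γ u ≡ r)
    (λ p _ e e′ → trans (reward-+[] γ p _ _) (cong₂ _+ᴿ[ p ]_ e e′))
    (λ (d , c) → trans (reward-· γ ⟦ d ⟧ᶜ (ηᵀ ⟦ c ⟧ᶜ)) (cong (⟦ d ⟧ᶜ +_) (reward-η γ ⟦ c ⟧ᶜ)))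

  𝐑-orˡ : ∀ {X} (F G : S X) γ → 𝐑⟨ F ∣ γ ⟩ ≤ 𝐑⟨ F orˢ G ∣ γ ⟩
  𝐑-orˡ F G γ with 𝐑⟨ G ∣ γ ⟩ ≤? 𝐑⟨ F ∣ γ ⟩
  ... | yes _ = ≤-refl
  ... | no G≰F with ≤-total 𝐑⟨ F ∣ γ ⟩ 𝐑⟨ G ∣ γ ⟩
  ...   | inj₁ F≤G = F≤G
  ...   | inj₂ G≤F = contradiction G≤F G≰F

  𝐑-orʳ : ∀ {X} (F G : S X) γ → 𝐑⟨ G ∣ γ ⟩ ≤ 𝐑⟨ F orˢ G ∣ γ ⟩
  𝐑-orʳ F G γ with 𝐑⟨ G ∣ γ ⟩ ≤? 𝐑⟨ F ∣ γ ⟩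
  ... | yes G≤F = G≤F
  ... | no _    = ≤-refl

  -- Since `orˢ` attains the larger of the two rewards, whatever dominates a choice dominates each
  -- alternative.
  optimal : ∀ {b} (N : Choice (Mixture (Leaf b))) {F : S ⟦ b ⟧ᵇ} →
            (∀ γ → 𝐑⟨ ⟦ N ⟧ᶜʰ ∣ γ ⟩ ≤ 𝐑⟨ F ∣ γ ⟩) →
            Allᶜ (λ E → ∀ γ → expected γ E ≤ 𝐑⟨ F ∣ γ ⟩) N
  optimal {b} (one E)  h = λ γ → ≤-trans (≤-reflexive (sym (reward-expected {b} γ E))) (h γ)
  optimal (M or N) h =
    optimal M (λ γ → ≤-trans (𝐑-orˡ ⟦ M ⟧ᶜʰ ⟦ N ⟧ᶜʰ γ) (h γ)) ,
    optimal N (λ γ → ≤-trans (𝐑-orʳ ⟦ M ⟧ᶜʰ ⟦ N ⟧ᶜʰ γ) (h γ))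

  -- Mixtures whose reward never exceeds that of `a`.

  module _ {b} (a : ⟦ b ⟧ᵇ) where

    test : R → R → ⟦ b ⟧ᵇ → R
    test l r x = if does (em {x ≡ a}) then l else r

    l≤test : ∀ {l r} x → l ≤ r → l ≤ test l r x
    l≤test x l≤r with does (em {x ≡ a})
    ... | true  = ≤-refl
    ... | false = l≤r

    test-a : ∀ l r → test l r a ≡ l
    test-a l r with em {a ≡ a}
    ... | yes _  = refl
    ... | no a≢a = contradiction refl a≢a

    atLeast : ∀ {s} (E : Mixture (Leaf b)) → Allᴹ (λ (d , _) → s ≤ ⟦ d ⟧ᶜ) E →
              AtLeast s (λ l r → expected (test l r) E)
    atLeast (pure (d , c)) s≤d l≤r = +-mono-≤ s≤d (l≤test ⟦ c ⟧ᶜ l≤r)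
    atLeast {s} (mix p i E E′) (h , h′) =
      AtLeast-+[] {s} {λ l r → expected (test l r) E} p i (atLeast E h) (atLeast E′ h′)

    -- A leaf returning something other than `a` earns `r` on top of its own reward. In a mixture
    -- one such operand is enough, as `atLeast` bounds the other.
    escapes : ∀ {s} (E : Mixture (Leaf b)) → Allᴹ (λ (d , _) → s ≤ ⟦ d ⟧ᶜ) E →
              Allᴹ (λ (_ , c) → ⟦ c ⟧ᶜ ≡ a) E ⊎ Escapes s (λ l r → expected (test l r) E)
    escapes {s} (pure (d , c)) s≤d with em {⟦ c ⟧ᶜ ≡ a}
    ... | yes c≡a = inj₁ c≡a
    ... | no _    = inj₂ (inj₁ λ _ → +-mono-≤ s≤d ≤-refl)
    escapes {s} (mix p i E E′) (h , h′) with escapes E h | escapes E′ h′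
    ... | inj₁ q | inj₁ q′ = inj₁ (q , q′)
    ... | inj₂ e | _       = inj₂ (Escapes-+[]ˡ {ρ₁ = λ l r → expected (test l r) E} p i e (atLeast E′ h′))
    ... | _      | inj₂ e  = inj₂ (Escapes-+[]ʳ {ρ₁ = λ l r → expected (test l r) E} p i (atLeast E h) e)

    -- The minimum of `0ᴿ` and the rewards at the finitely many leaves.
    lower-bound : (E : Mixture (Leaf b)) → ∃ λ s → s ≤ 0ᴿ × Allᴹ (λ (d , _) → s ≤ ⟦ d ⟧ᶜ) E
    lower-bound (pure (d , c)) with ≤-total ⟦ d ⟧ᶜ 0ᴿ
    ... | inj₁ d≤0 = ⟦ d ⟧ᶜ , d≤0 , ≤-refl
    ... | inj₂ 0≤d = 0ᴿ , ≤-refl , 0≤d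
    lower-bound (mix p i E E′) with lower-bound E | lower-bound E′
    ... | s , s≤0 , h | s′ , s′≤0 , h′ with ≤-total s s′
    ...   | inj₁ s≤s′ = s , s≤0 , h , Allᴹ-map (≤-trans s≤s′) E′ h′
    ...   | inj₂ s′≤s = s′ , s′≤0 , Allᴹ-map (≤-trans s′≤s) E h , h′

    bounded⇒constant : (E : Mixture (Leaf b)) → (∀ γ → expected γ E ≤ γ a) →
                       Allᴹ (λ (_ , c) → ⟦ c ⟧ᶜ ≡ a) E
    bounded⇒constant E bounded with lower-bound E
    ... | s , s≤0 , h with escapes E h
    ...   | inj₁ q = q
    -- At the reward function `test l r` the assumed bound is `l`, which an escaping mixture cannot
    -- respect for all `l` and `r`.
    ...   | inj₂ e = ⊥-elim (¬bounded s≤0 e λ l r →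
              subst (expected (test l r) E ≤_) (test-a l r) (bounded (test l r)))

  -- Mixtures and choices have at least one leaf; its constant will serve as the `c` to which every
  -- leaf is compared.
  someConᴹ : ∀ {b} {P : Con b → Set} (E : Mixture (Leaf b)) → Allᴹ (P ∘ proj₂) E → Σ (Con b) P
  someConᴹ (pure (_ , c)) h       = c , h
  someConᴹ (mix _ _ E _)  (h , _) = someConᴹ E h

  someConᶜ : ∀ {b} {P : Con b → Set} (N : Choice (Mixture (Leaf b))) →
             Allᶜ (Allᴹ (P ∘ proj₂)) N → Σ (Con b) P
  someConᶜ (one E)  h       = someConᴹ E h
  someConᶜ (M or _) (h , _) = someConᶜ M h

  -- Choices among mixtures that return a single constant.

  module _ {b} (c₀ : Con b) where

    returning : Mixture (Con rew) → Mixture (Leaf b)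
    returning = mapᴹ (_, c₀)

    returning-proj₁ : (E : Mixture (Leaf b)) → Allᴹ (λ (_ , c) → c ≡ c₀) E →
                      returning (mapᴹ proj₁ E) ≡ E
    returning-proj₁ (pure (d , c)) refl     = refl
    returning-proj₁ (mix p i E E′) (h , h′) =
      cong₂ (mix p i) (returning-proj₁ E h) (returning-proj₁ E′ h′)

    mean : Mixture (Con rew) → R
    mean = fold _+ᴿ[_]_ ⟦_⟧ᶜ

    -- Distributivity extracts the common summand `γ ⟦ c₀ ⟧ᶜ`, so comparing two such mixtures
    -- amounts to comparing their means.
    expected-returning : ∀ γ D → expected γ (returning D) ≡ mean D + γ ⟦ c₀ ⟧ᶜ
    expected-returning γ (pure d)       = refl
    expected-returning γ (mix p i D D′) =
      trans (cong₂ _+ᴿ[ p ]_ (expected-returning γ D) (expected-returning γ D′)) (sym (+-distribʳ p _ _ _))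

    reward-returning : ∀ γ D → reward γ ⟦ returning D ⟧ᴹ ≡ mean D + γ ⟦ c₀ ⟧ᶜ
    reward-returning γ D = trans (reward-expected {b} γ (returning D)) (expected-returning γ D)

    weightsOf : (D : Mixture (Con rew)) → Weights (size (toComb D))
    weightsOf D = toWeights (toComb D)

    rewardsOf : (D : Mixture (Con rew)) → Vec (Con rew) (suc (size (toComb D)))
    rewardsOf D = leaves (toComb D)

    inner : Mixture (Con rew) → Inner []
    inner D = record { q = weightsOf D ; rewards = Vec.map con (rewardsOf D) }

    -- `Weights 0` consists of one weight: a single outer summand suffices, as all leaves return
    -- `c₀`.
    certain : Weights 0
    certain = mkWeights (1𝕀 ∷ []) (Reals.+-identityʳ 𝓡 _)

    prForm-returning : ∀ D → Ax ⊢ mixtureTerm (returning D) ≐ prForm certain (con c₀ ∷ []) (inner D ∷ [])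
    prForm-returning D = ≐-trans
      (≡⇒≐ (fold-mapᴹ _+[_]_ leafTerm (_, c₀) D))
      (≐-trans (fold-∑ _+[_]_ (λ M N → Ax ⊢ M ≐ N)
                 (record { refl = ≐-refl ; sym = ≐-sym ; trans = ≐-trans })
                 cong-+[] (λ p q p<1 q<1 L M N → ax₁ (+[]-assoc p q p<1 q<1 L M N))
                 (λ d → con d · con c₀) D)
        (≡⇒≐ (cong (∑ _+[_]_ (weightsOf D)) (map-∘ (λ M → ⌜ M ⌝ · con c₀) con (rewardsOf D)))))

    _⊕ᶜ[_]_ : Con rew → 𝕀 → Con rew → Con rew
    d ⊕ᶜ[ p ] d′ = valᶠ (⊕ᶠ p) (d ∷ d′ ∷ [])

    -- The map by `id` gives the sum the shape that `iterate-rel` expects.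
    meanCon : Mixture (Con rew) → Con rew
    meanCon D = ∑ _⊕ᶜ[_]_ (weightsOf D) (Vec.map id (rewardsOf D))

    meanCon-⟦⟧ : ∀ D → ⟦ meanCon D ⟧ᶜ ≡ mean D
    meanCon-⟦⟧ D = trans
      (iterate-rel (λ c r → ⟦ c ⟧ᶜ ≡ r)
        (λ p {x} {y} e e′ → trans (sym (⟦val⟧ (⊕ᶠ p) (x ∷ y ∷ [])))
          (trans (⟦⊕⟧ p _ _) (cong₂ _+ᴿ[ p ]_ e e′)))
        (λ _ → refl) (weights (weightsOf D)) (rewardsOf D))
      (sym (fold-∑ _+ᴿ[_]_ _≡_ isEquivalence (λ p → cong₂ _+ᴿ[ p ]_)
        (λ p q p<1 q<1 → assoc p q p<1 q<1) ⟦_⟧ᶜ D))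

    Eₛ-inner : ∀ D → Ax ⊢ Eₛ certain (inner D ∷ []) ≐ con (meanCon D)
    Eₛ-inner D = ≐-trans
      (≡⇒≐ (cong (∑ _⊕[_]_ (weightsOf D)) (sym (map-∘ ⌜_⌝ con (rewardsOf D)))))
      (iterate-rel (λ M d → Ax ⊢ M ≐ con d)
        (λ p e e′ → ≐-trans (cong-fun (⊕ᶠ p) (e ∷ (e′ ∷ []))) (fun-val (⊕ᶠ p) _))
        (λ _ → ≐-refl) (weights (weightsOf D)) (rewardsOf D))

    comparison : ∀ D D′ → Ax ⊢ (Eₛ certain (inner D ∷ []) ≥ᵗ Eₛ certain (inner D′ ∷ [])) ≐
                 con (valᶠ ≤ᶠ (meanCon D′ ∷ meanCon D ∷ []))
    comparison D D′ = ≐-trans (cong-fun ≤ᶠ (Eₛ-inner D′ ∷ (Eₛ-inner D ∷ []))) (fun-val ≤ᶠ _)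

    ⟦comparison⟧ : ∀ D D′ → does (mean D′ ≤? mean D) ≡ ⟦ valᶠ ≤ᶠ (meanCon D′ ∷ meanCon D ∷ []) ⟧ᶜ
    ⟦comparison⟧ D D′ = trans
      (cong₂ (λ r s → does (r ≤? s)) (sym (meanCon-⟦⟧ D′)) (sym (meanCon-⟦⟧ D)))
      (trans (sym (⟦≤⟧ _ _)) (⟦val⟧ ≤ᶠ (meanCon D′ ∷ meanCon D ∷ [])))

    larger : Mixture (Con rew) → Mixture (Con rew) → Mixture (Con rew)
    larger D D′ = if does (mean D′ ≤? mean D) then D else D′

    -- In expectation PR-form the choice equals a conditional by `ite-or`. Its test compares
    -- expectations of constants, so it evaluates to a Boolean constant.
    or-larger-≐ : ∀ D D′ → Ax ⊢ (mixtureTerm (returning D) or mixtureTerm (returning D′)) ≐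
                  mixtureTerm (returning (larger D D′))
    or-larger-≐ D D′ = ≐-trans (cong-or (prForm-returning D) (prForm-returning D′))
      (≐-trans (≐-sym (ax₁ (ite-or certain (con c₀ ∷ []) (inner D ∷ []) (inner D′ ∷ []))))
      (≐-trans (cong-ite (comparison D D′) (≐-sym (prForm-returning D)) (≐-sym (prForm-returning D′)))
               (choose _ _ (⟦comparison⟧ D D′))))
      where
      -- The test is generalised to a Boolean `t`, so that splitting on it also computes the chosen
      -- mixture.
      choose : ∀ t c → t ≡ ⟦ c ⟧ᶜ →
               Ax ⊢ ite (con c) (mixtureTerm (returning D)) (mixtureTerm (returning D′)) ≐
                    mixtureTerm (returning (if t then D else D′))
      choose true  c eq with ⟦⟧ᶜ-injective (trans ⟦tt⟧ eq)
      ... | refl = ite-tt _ _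
      choose false c eq with ⟦⟧ᶜ-injective (trans ⟦ff⟧ eq)
      ... | refl = ite-ff _ _

    -- The reward of `c₀` cancels from the comparison, hence the same mixture wins under every `γ`.
    or-larger-⟦⟧ : ∀ D D′ → ((λ _ → ⟦ returning D ⟧ᴹ) orˢ (λ _ → ⟦ returning D′ ⟧ᴹ)) ≡
                   (λ _ → ⟦ returning (larger D D′) ⟧ᴹ)
    or-larger-⟦⟧ D D′ = ext pointwise
      where
      same-order : ∀ γ → (mean D′ ≤ mean D) ⇔ (reward γ ⟦ returning D′ ⟧ᴹ ≤ reward γ ⟦ returning D ⟧ᴹ)
      same-order γ = subst₂ (λ r s → (mean D′ ≤ mean D) ⇔ (r ≤ s))
        (sym (reward-returning γ D′)) (sym (reward-returning γ D)) (+-≤-⇔ _ _ _)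
      pointwise : ∀ γ → ((λ _ → ⟦ returning D ⟧ᴹ) orˢ (λ _ → ⟦ returning D′ ⟧ᴹ)) γ ≡
                        ⟦ returning (larger D D′) ⟧ᴹ
      pointwise γ
        rewrite sym (does-⇔ (same-order γ) (mean D′ ≤? mean D)
                       (reward γ ⟦ returning D′ ⟧ᴹ ≤? reward γ ⟦ returning D ⟧ᴹ))
        with does (mean D′ ≤? mean D)
      ... | true  = refl
      ... | false = refl

    -- The equation between denotations accompanies the provable one because the purity of the final
    -- mixture is read off from it.
    best : (N : Choice (Mixture (Leaf b))) → Allᶜ (Allᴹ (λ (_ , c) → c ≡ c₀)) N →
           ∃ λ D → (Ax ⊢ choiceTerm N ≐ mixtureTerm (returning D)) × ⟦ N ⟧ᶜʰ ≡ (λ _ → ⟦ returning D ⟧ᴹ)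
    best (one E) h = mapᴹ proj₁ E , ≡⇒≐ (cong mixtureTerm (sym E≡)) , ext λ _ → cong ⟦_⟧ᴹ (sym E≡)
      where E≡ = returning-proj₁ E h
    best (M or N) (h , h′) = let (D , M≐ , M≡) = best M h ; (D′ , N≐ , N≡) = best N h′ in
      larger D D′ , ≐-trans (cong-or M≐ N≐) (or-larger-≐ D D′) ,
      trans (cong₂ _orˢ_ M≡ N≡) (or-larger-⟦⟧ D D′)

  -- Reduction of pure programs to pure mixtures.

  pure⇒mixture : ∀ {b} (M : Program (base b)) → ⊨ (M ↓) →
    Σ (Mixture (Leaf b)) λ E → (Ax ⊢ M ≐ mixtureTerm E) × ⊨ (mixtureTerm E ↓)
  pure⇒mixture {b} M M↓ = returning c₀ D , ≐-trans M≐M′ (≐-trans M′≐N N≐E) ,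
    λ where [] → a , trans (mixtureTerm-sound (returning c₀ D)) (trans (sym N≡E) N≡η)
    where
    -- The fundamental lemma speaks of substitution instances; the empty substitution returns `M`
    -- only up to `sub-id`.
    M′ = sub (λ ()) M
    M≐M′ : Ax ⊢ M ≐ M′
    M≐M′ = ≡⇒≐ (sym (sub-id (λ ()) M))
    nf = normalise (computable M {θ = λ ()} {ρ = []} λ ())
    N = proj₁ nf
    M′≐N = proj₁ (proj₂ nf)
    a = proj₁ (M↓ [])
    N≡η : ⟦ N ⟧ᶜʰ ≡ η a
    N≡η = trans (sym (proj₂ (proj₂ nf))) (proj₂ (M↓ []))
    denote-a : Allᶜ (Allᴹ (λ (_ , c) → ⟦ c ⟧ᶜ ≡ a)) N
    denote-a = Allᶜ-map
      -- The reward of `η a` under `γ` is `γ a`, so optimality is the bound that `bounded⇒constant`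
      -- asks for.
      (λ {E} h → bounded⇒constant a E λ γ → ≤-trans (h γ) (≤-reflexive (reward-η γ a))) N
      (optimal N {η a} λ γ → subst (λ F → 𝐑⟨ ⟦ N ⟧ᶜʰ ∣ γ ⟩ ≤ 𝐑⟨ F ∣ γ ⟩) N≡η ≤-refl)
    c₀ = proj₁ (someConᶜ N denote-a)
    bestD = best c₀ N (Allᶜ-map (λ {E} → Allᴹ-map
      (λ c≡a → ⟦⟧ᶜ-injective (trans c≡a (sym (proj₂ (someConᶜ N denote-a))))) E) N denote-a)
    D = proj₁ bestD
    N≐E = proj₁ (proj₂ bestD)
    N≡E = proj₂ (proj₂ bestD)

theorem5p21 : ExcludedMiddle 0ℓ → Extensionality 0ℓ 0ℓ →
    (𝓡 : Reals) (Sig : Signature 𝓡) (Rw : Rewards 𝓡)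
    (I : Interpretation 𝓡 Sig Rw) (𝓣 : AuxiliaryMonad 𝓡 Rw) →
    let open Language 𝓡 Sig
        open Semantics 𝓡 Sig Rw I 𝓣
    in
    Rewards.ConditionC Rw →
    (Ax : Theory) → Ax₁ ⊑ Ax → Valid Ax →
    StronglyPurityCompleteForBasicPREffectValues Ax →
    StronglyPurityCompleteAtBaseTypes Ax
theorem5p21 em ext 𝓡 Sig Rw I 𝓣 conditionC Ax Ax₁⊑Ax _ complete M M↓ =
  let (E , M≐E , E↓) = pure⇒mixture M M↓
      (c , E≐c)      = complete (mixtureTerm E) (mixtureTerm-value E) E↓
  in c , ≐-trans M≐E E≐c
  where
  open Language 𝓡 Sig using (≐-trans)
  open NormalForm ext 𝓡 Sig Rw I 𝓣 Ax Ax₁⊑Ax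
  open PurityCompleteness em ext 𝓡 Sig Rw I 𝓣 conditionC Ax Ax₁⊑Ax
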